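{- Let $n\ge 13$ be an integer and suppose $n=5k+3l$ with integers $k$ and $l$, $0\le l\le 4$. Then $$\operatorname{Pg}(n)\le 2n+k+l,$$ where $\operatorname{Pg}(n)$ is the minimum number of pentagons in a $3$-connected pentagulation of an $n$-gon.
   Context: All graphs are finite, undirected and simple (no loops, no multiple edges). A pentagulation of an $n$-gon (of a simple cycle $C_n$ of length $n\ge 3$ in the plane) is a connected plane graph all of whose faces have length five, except for one face, which has length $n$ and is bounded by the cycle $C_n$; its number of pentagons is the number of faces of length five other than the distinguished face bounded by $C_n$. A graph $G$ is $k$-connected if $|V(G)|>k$ and deleting any at most $k-1$ vertices leaves a connected graph. $\operatorname{Pg}(n)$ denotes the smallest number of pentagons among all $3$-connected pentagulations of an $n$-gon. -}

module Defs where

open import Data.Bool using (Bool; T)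
open import Data.Fin using (Fin; toℕ)
open import Data.Fin.Subset using (Subset; ∣_∣; _∉_)
open import Data.Nat using (ℕ; pred; _+_; _*_; _≤_; _<_)
open import Data.Nat.GeneralisedArithmetic using (fold)
open import Data.Product using (_×_; ∃; ∃-syntax)
open import Data.Vec using (sum; tabulate)
open import Function.Bundles using (Inverse)
open import Function.Definitions using (Injective)
open import Relation.Binary using (Rel; Setoid)
open import Relation.Binary.Construct.Closure.Equivalence using (EqClosure)
  renaming (setoid to closureSetoid)
open import Relation.Binary.Construct.Closure.ReflexiveTransitive using (Star)
open import Relation.Binary.PropositionalEquality using (_≡_; _≢_; setoid)
open import Relation.Nullary using (¬_)
import Level

record Graph : Set where
  field
    order  : ℕ
    adj    : Fin order → Fin order → Bool

  Vertex : Set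
  Vertex = Fin order

  Adj : Rel Vertex Level.zero
  Adj u v = T (adj u v)

  field
    symmetric   : ∀ {u v} → Adj u v → Adj v u
    irreflexive : ∀ {v} → ¬ Adj v v

  degree : Vertex → ℕ
  degree u = ∣ tabulate (adj u) ∣

  -- Twice the number of edges.
  degreeSum : ℕ
  degreeSum = sum (tabulate degree)

  Connected : Set
  Connected = ∀ u v → Star Adj u v

  ConnectedWithout : Subset order → Set
  ConnectedWithout S = ∀ {u v} → u ∉ S → v ∉ S →
    Star (λ a b → a ∉ S × b ∉ S × Adj a b) u v

  record Dart : Set where
    constructor dart
    field
      {tail head} : Vertex
      adjacent    : Adj tail head

infix 4 _-Connected_

_-Connected_ : ℕ → Graph → Set
k -Connected G = k < order × (∀ S → ∣ S ∣ < k → ConnectedWithout S)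
  where open Graph G

-- Connected plane graphs with at least one edge, up to homeomorphism of the
-- sphere, given as combinatorial maps: a rotation at every vertex, with
-- Euler characteristic 2.
record PlaneGraph : Set where
  field
    graph : Graph

  open Graph graph public

  field
    connected : Connected
    -- rot u v is the neighbour of u that follows v around u.  Its value is
    -- irrelevant when v is not a neighbour of u.
    rot        : Vertex → Vertex → Vertex
    rot-adj    : ∀ {u v} → Adj u v → Adj u (rot u v)
    -- A self-map of a finite set whose iterates lead from any element to any
    -- other is a cyclic permutation of that set.
    rot-cyclic : ∀ {u v w} → Adj u v → Adj u w → ∃[ k ] fold v (rot u) k ≡ w

  -- The next dart along the boundary walk of the face beside a given dart.
  faceStep : Dart → Dart
  faceStep (dart uv) = dart (rot-adj (symmetric uv))

  walk : Dart → ℕ → Dart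
  walk d = fold d faceStep

  -- faceStep permutes the darts, and the faces are its orbits; the orbits are
  -- the classes of the equivalence relation generated by d ∼ faceStep d.
  Faces : Setoid _ _
  Faces = closureSetoid (λ d e → faceStep d ≡ e)

  SameFace : Rel Dart _
  SameFace = Setoid._≈_ Faces

  -- The face beside d has length m, i.e. its boundary walk closes up for the
  -- first time after m steps.
  FaceLength : Dart → ℕ → Set
  FaceLength d m = 0 < m × walk d m ≡ d × (∀ j → 0 < j → j < m → walk d j ≢ d)

  field
    faceCount : ℕ
    faces     : Inverse Faces (setoid (Fin faceCount))
    -- Twice Euler's formula V + F = E + 2.
    euler     : 2 * order + 2 * faceCount ≡ degreeSum + 4

-- The distinguished face is the one beside the dart outer.
record Pentagulation (n : ℕ) : Set where
  field
    planeGraph : PlaneGraph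

  open PlaneGraph planeGraph public

  field
    3≤n          : 3 ≤ n
    outer        : Dart
    outer-length : FaceLength outer n
    -- The boundary walk of the distinguished face repeats no vertex, so it is
    -- a cycle.
    outer-cycle  : Injective _≡_ _≡_ (λ (i : Fin n) → Dart.tail (walk outer (toℕ i)))
    pentagonal   : ∀ d → ¬ SameFace outer d → FaceLength d 5

  -- Every face but the distinguished one is counted.
  pentagons : ℕ
  pentagons = pred faceCount

-- IsPg n m says that Pg(n) = m.
IsPg : ℕ → ℕ → Set
IsPg n m =
    (∃ λ (P : Pentagulation n) →
       3 -Connected Pentagulation.graph P × Pentagulation.pentagons P ≡ m)
  × (∀ (P : Pentagulation n) →
       3 -Connected Pentagulation.graph P → m ≤ Pentagulation.pentagons P)

{-# OPTIONS --safe #-}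
module Submission where

-- Surround the n-gon by two rings of n pentagons: inside the outer cycle of the vertices a lies a cycle of length
-- 2n through alternating vertices b and c, and inside that a closed walk of length n, each of whose steps has a c
-- next to it.  The walk runs around a wheel of k + l pentagons with a common vertex z: k of them meet the preceding
-- one only in z and account for five steps each, the other l share an edge at z with the preceding one and account
-- for three.  This is where n = 5k + 3l comes from; k is positive since 3l ≤ 12 < n.
--
-- The minimum is attained, constructively, because a 3-connected pentagulation has minimum degree three, so that
-- Euler's formula bounds its order by twice its number of faces and leaves a finite search.

open import Defs
open import Data.Integer using (ℤ; +_; _+_; _*_; _≤_)
open import Data.Nat using (ℕ)
open import Data.Product using (_×_; ∃-syntax)
open import Relation.Binary.PropositionalEquality using (_≡_)
open import Data.Bool using (Bool; true; false; T)
open import Data.Bool.Properties using (T-irrelevant; T-≡)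
open import Data.Fin as Fin using (Fin; zero; suc; toℕ; fromℕ<)
open import Data.Fin.Patterns using (0F; 1F; 2F; 3F; 4F)
open import Data.Fin.Permutation using (↔⇒≡)
import Data.Fin.Properties as Finₚ
open import Data.Fin.Relation.Unary.Top using (view; ‵fromℕ; ‵inject₁; view-fromℕ; view-inject₁)
open import Data.Fin.Subset using (Subset; ∣_∣; _∈_; _∉_; ⁅_⁆)
open import Data.Fin.Subset.Properties
  using (_∈?_; anySubset?; x∈p⇒∣p-x∣<∣p∣; x∈p∧x≢y⇒x∈p-y; ∉⊥; ∣⊥∣≡0
  ; p⊆q⇒∣p∣≤∣q∣; ∣⁅x⁆∣≡1; ∣∁p∣≡n∸∣p∣; x∈∁p⇒x∉p; x∈⁅x⁆)
open import Data.Integer using (-[1+_]; +≤+; -≤+)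
import Data.Integer.Properties as ℤₚ
open import Data.List using (List; []; _∷_; allFin; cartesianProduct)
import Data.List.Membership.Propositional as Listₘ
open import Data.List.Membership.Propositional.Properties using (∈-allFin; ∈-cartesianProduct⁺)
open import Data.List.Relation.Unary.Any using (here; there)
open import Data.Nat as ℕ using (zero; suc; z≤n; s≤s)
open import Data.Nat.DivMod using (_%_; _/_; m≡m%n+[m/n]*n; m%n<n)
open import Data.Nat.GeneralisedArithmetic using (fold; fold-+)
open import Data.Nat.Induction using (<-wellFounded)
import Data.Nat.Properties as ℕₚ
open import Data.Nat.Tactic.RingSolver using (solve-∀)
open import Data.Product using (Σ; _,_; ∃; proj₁; proj₂)
open import Data.Product.Function.Dependent.Propositional using (Σ-↔)
open import Data.Product.Function.NonDependent.Propositional using (_×-↔_)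
open import Data.Product.Properties using (≡-dec)
open import Data.Sum using (_⊎_; inj₁; inj₂)
open import Data.Sum.Function.Propositional using (_⊎-↔_)
open import Data.Unit using (⊤; tt)
open import Data.Vec using (Vec; []; _∷_; sum; tabulate; lookup)
open import Data.Vec.Properties using (lookup∘tabulate; tabulate-cong; []=⇒lookup; lookup⇒[]=)
open import Function using (_∘_; _$_; case_of_)
open import Function.Bundles using (Inverse; Equivalence; _↔_; mk↔ₛ′)
open import Function.Construct.Composition using (_↔-∘_)
open import Function.Construct.Identity using (↔-id)
open import Function.Construct.Symmetry using (↔-sym)
open import Function.Definitions using (Injective)
open import Function.Properties.Inverse using (↔⇒↣)
open import Induction.WellFounded using (Acc; acc)
import Level
open import Relation.Binary using (Rel)
open import Relation.Binary.Construct.Closure.Equivalence using (EqClosure)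
import Relation.Binary.Construct.Closure.Equivalence as EqClosure
open import Relation.Binary.Construct.Closure.ReflexiveTransitive as Star using (Star; ε; _◅_; _◅◅_)
open import Relation.Binary.Construct.Closure.Symmetric using (SymClosure; fwd; bwd)
open import Relation.Binary.Definitions using (DecidableEquality; tri<; tri≈; tri>)
open import Relation.Binary.PropositionalEquality
  using (_≢_; refl; sym; ≢-sym; trans; cong; cong₂; subst; subst₂; isEquivalence; module ≡-Reasoning)
open import Relation.Nullary using (¬_; Dec; yes; no; contradiction)
open import Relation.Nullary.Decidable
  using (⌊_⌋; T?; ¬?; _×-dec_; _⊎-dec_; _→-dec_; decidable-stable; fromWitness; from-yes; map′; toWitness)

-- Orbits of a self-map

-- A ring pentagon with two spokes has three further edges. In the outer ring one of them lies on
-- the `n`-gon and two on the cycle of the `b`s and `c`s; in the inner ring it is the other way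
-- round. The lengths thus run `n`, `2n`, `n`, and what fills the centre must have a boundary walk
-- of length `n`. The boundary walk of the wheel passes through `z` once for each of the `k`
-- sectors, so it need not be a cycle; 3-connectedness gets by with the weaker fact that two
-- successive steps of it never lead back. Describing a dart by its face and its position there
-- makes the lengths of the pentagons evident and moves the geometry into the involution `rev`. A
-- plane graph contains functions and a bijection onto a quotient, which cannot be enumerated
-- directly. The search therefore runs over tables, with a face label for every dart and a
-- representative dart for every face.

Reach : {A : Set} → (A → A) → A → A → Set
Reach f x y = ∃[ k ] fold x f k ≡ y

OrbitLength : {A : Set} → (A → A) → A → ℕ → Set
OrbitLength f x m = 0 ℕ.< m × fold x f m ≡ x × (∀ j → 0 ℕ.< j → j ℕ.< m → fold x f j ≢ x)

module _ {A : Set} {f : A → A} where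

  reach-trans : ∀ {x y z} → Reach f x y → Reach f y z → Reach f x z
  reach-trans {x} (j , refl) (k , refl) = k ℕ.+ j , fold-+ x f k

  fold-suc : ∀ x k → fold (f x) f k ≡ f (fold x f k)
  fold-suc x zero    = refl
  fold-suc x (suc k) = cong f (fold-suc x k)

  fold-* : ∀ {x j} → fold x f j ≡ x → ∀ q → fold x f (q ℕ.* j) ≡ x
  fold-* eq zero = refl
  fold-* {x} {j} eq (suc q) =
    trans (fold-+ x f j) (trans (cong (λ y → fold y f j) (fold-* eq q)) eq)

  fold-% : ∀ {x j} .{{_ : ℕ.NonZero j}} → fold x f j ≡ x → ∀ k → fold x f (k % j) ≡ fold x f k
  fold-% {x} {j} eq k = sym (begin
    fold x f k                            ≡⟨ cong (fold x f) (m≡m%n+[m/n]*n k j) ⟩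
    fold x f (k % j ℕ.+ k / j ℕ.* j)      ≡⟨ fold-+ x f (k % j) ⟩
    fold (fold x f (k / j ℕ.* j)) f (k % j) ≡⟨ cong (λ y → fold y f (k % j)) (fold-* eq (k / j)) ⟩
    fold x f (k % j)                      ∎)
    where open ≡-Reasoning

  fold-injective : Injective _≡_ _≡_ f → ∀ k → Injective _≡_ _≡_ (λ x → fold x f k)
  fold-injective inj zero    eq = eq
  fold-injective inj (suc k) eq = fold-injective inj k (inj eq)

  fold-cancel : Injective _≡_ _≡_ f → ∀ {x i j} → i ℕ.≤ j →
    fold x f i ≡ fold x f j → fold x f (j ℕ.∸ i) ≡ x
  fold-cancel inj {x} {i} {j} i≤j eq = fold-injective inj i $ begin
    fold (fold x f (j ℕ.∸ i)) f i ≡⟨ sym (fold-+ x f i) ⟩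
    fold x f (i ℕ.+ (j ℕ.∸ i))    ≡⟨ cong (fold x f) (ℕₚ.m+[n∸m]≡n i≤j) ⟩
    fold x f j                    ≡⟨ sym eq ⟩
    fold x f i                    ∎
    where open ≡-Reasoning

module FiniteDynamics {A : Set} {n : ℕ} (A↔ : A ↔ Fin n)
                      (f : A → A) (f-injective : Injective _≡_ _≡_ f) where

  open Inverse A↔ using (to; from; strictlyInverseʳ; strictlyInverseˡ)

  private
    to-injective : Injective _≡_ _≡_ to
    to-injective eq = trans (sym (strictlyInverseʳ _)) (trans (cong from eq) (strictlyInverseʳ _))

  -- Two of the first `n + 1` iterates coincide, and injectivity cancels the smaller exponent. The
  -- witness is the period minus one.
  period : ∀ x → ∃[ j ] (j ℕ.< n × fold x f (suc j) ≡ x)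
  period x with Finₚ.pigeonhole (ℕₚ.n<1+n n) (λ i → to (fold x f (toℕ i)))
  ... | i , j , i<j , eq with toℕ j ℕ.∸ toℕ i in j∸i | fold-cancel f-injective (ℕₚ.<⇒≤ i<j) (to-injective eq)
  ...   | zero  | _  = contradiction (ℕₚ.m∸n≡0⇒m≤n j∸i) (ℕₚ.<⇒≱ i<j)
  ...   | suc p | eq = p , 1+p≤n , eq
    where
    1+p≤n : p ℕ.< n
    1+p≤n = subst (ℕ._≤ n) j∸i (ℕₚ.≤-trans (ℕₚ.m∸n≤m (toℕ j) (toℕ i)) (ℕₚ.<⇒≤pred (Finₚ.toℕ<n j)))

  -- Orbits of an injective self-map of a finite set are cycles, so each step is undone by
  -- completing the period.
  reach-sym : ∀ {x y} → Reach f x y → Reach f y x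
  reach-sym (zero  , refl) = 0 , refl
  reach-sym {x} (suc k , refl) = reach-trans back (reach-sym (k , refl))
    where
    back : Reach f (f (fold x f k)) (fold x f k)
    back with period (fold x f k)
    ... | j , _ , eq = j , trans (fold-suc _ j) eq

  module Transitive (transitive : ∀ x y → Reach f x y) where

    -- An iterate f^j fixing x with j > 0 makes every point one of the first j iterates of x.
    period-minimal : ∀ {x j} → 0 ℕ.< j → j ℕ.< n → fold x f j ≢ x
    period-minimal {x} {j@(suc _)} _ j<n eq = Finₚ.<⇒notInjective {f = index} j<n index-injective
      where
      index : Fin n → Fin j
      index i = fromℕ< (m%n<n (proj₁ (transitive x (from i))) j)

      fold-index : ∀ i → fold x f (toℕ (index i)) ≡ from i
      fold-index i = let k , fᵏx≡i = transitive x (from i) in begin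
        fold x f (toℕ (index i)) ≡⟨ cong (fold x f) (Finₚ.toℕ-fromℕ< (m%n<n k j)) ⟩
        fold x f (k % j)         ≡⟨ fold-% {j = j} eq k ⟩
        fold x f k               ≡⟨ fᵏx≡i ⟩
        from i                   ∎
        where open ≡-Reasoning

      index-injective : Injective _≡_ _≡_ index
      index-injective {i} {i′} eq′ = trans (sym (strictlyInverseˡ i)) (trans
        (cong to (trans (sym (fold-index i)) (trans (cong (λ r → fold x f (toℕ r)) eq′) (fold-index i′))))
        (strictlyInverseˡ i′))

    full-period : ∀ x → fold x f n ≡ x
    full-period x with period x
    ... | j , j<n , eq with ℕₚ.m≤n⇒m<n∨m≡n j<n
    ...   | inj₁ j<n  = contradiction eq (period-minimal (s≤s z≤n) j<n)
    ...   | inj₂ refl = eq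

    iterates-injective : ∀ x → Injective _≡_ _≡_ (λ (i : Fin n) → fold x f (toℕ i))
    iterates-injective x {i} {j} eq with ℕₚ.<-cmp (toℕ i) (toℕ j)
    ... | tri< i<j _ _ = contradiction (fold-cancel f-injective (ℕₚ.<⇒≤ i<j) eq)
                           (period-minimal (ℕₚ.m<n⇒0<n∸m i<j) (ℕₚ.≤-<-trans (ℕₚ.m∸n≤m (toℕ j) (toℕ i)) (Finₚ.toℕ<n j)))
    ... | tri≈ _ i≡j _ = Finₚ.toℕ-injective i≡j
    ... | tri> _ _ j<i = contradiction (fold-cancel f-injective (ℕₚ.<⇒≤ j<i) (sym eq))
                           (period-minimal (ℕₚ.m<n⇒0<n∸m j<i) (ℕₚ.≤-<-trans (ℕₚ.m∸n≤m (toℕ i) (toℕ j)) (Finₚ.toℕ<n i)))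

-- Counting darts

Σ-Fin-suc : ∀ {n} {P : Fin (suc n) → Set} → Σ (Fin (suc n)) P ↔ (P zero ⊎ Σ (Fin n) (P ∘ suc))
Σ-Fin-suc = mk↔ₛ′
  (λ { (zero , p) → inj₁ p ; (suc i , p) → inj₂ (i , p) })
  (λ { (inj₁ p) → zero , p ; (inj₂ (i , p)) → suc i , p })
  (λ { (inj₁ p) → refl ; (inj₂ (i , p)) → refl })
  (λ { (zero , p) → refl ; (suc i , p) → refl })

count-↔ : ∀ {n} (b : Fin n → Bool) → Σ (Fin n) (T ∘ b) ↔ Fin ∣ tabulate b ∣
count-↔ {zero}  b = mk↔ₛ′ (λ ()) (λ ()) (λ ()) (λ ())
count-↔ {suc n} b with b zero in b₀ | count-↔ (b ∘ suc)
... | true  | ih = ↔-sym Finₚ.+↔⊎ ↔-∘ ((unit ⊎-↔ ih) ↔-∘ Σ-Fin-suc)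
  where
  unit : T (b zero) ↔ Fin 1
  unit = mk↔ₛ′ (λ _ → zero) (λ _ → subst T (sym b₀) _) (λ { zero → refl }) (λ _ → T-irrelevant _ _)
... | false | ih = ih ↔-∘ (mk↔ₛ′ skip (inj₂) (λ _ → refl) inverse ↔-∘ Σ-Fin-suc)
  where
  skip : T (b zero) ⊎ Σ (Fin n) (T ∘ b ∘ suc) → Σ (Fin n) (T ∘ b ∘ suc)
  skip (inj₁ t) = contradiction (subst T b₀ t) λ ()
  skip (inj₂ s) = s

  inverse : ∀ s → inj₂ (skip s) ≡ s
  inverse (inj₁ t) = contradiction (subst T b₀ t) λ ()
  inverse (inj₂ s) = refl

sum-↔ : ∀ {n} (g : Fin n → ℕ) → Σ (Fin n) (Fin ∘ g) ↔ Fin (sum (tabulate g))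
sum-↔ {zero}  g = mk↔ₛ′ (λ ()) (λ ()) (λ ()) (λ ())
sum-↔ {suc n} g = ↔-sym Finₚ.+↔⊎ ↔-∘ ((↔-id _ ⊎-↔ sum-↔ (g ∘ suc)) ↔-∘ Σ-Fin-suc)

module _ (G : Graph) where
  open Graph G

  -- The handshake lemma, which converts a count of darts into the `degreeSum` of Euler's formula.
  darts-↔ : Dart ↔ Fin degreeSum
  darts-↔ = sum-↔ degree ↔-∘ (Σ-↔ (↔-id _) (count-↔ (adj _)) ↔-∘ pairs)
    where
    pairs : Dart ↔ Σ Vertex λ u → Σ Vertex λ v → Adj u v
    pairs = mk↔ₛ′ (λ (dart uv) → _ , _ , uv) (λ (_ , _ , uv) → dart uv) (λ _ → refl) (λ _ → refl)

  dart-≡ : {d e : Dart} → Dart.tail d ≡ Dart.tail e → Dart.head d ≡ Dart.head e → d ≡ e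
  dart-≡ {dart p} {dart q} refl refl = cong dart (T-irrelevant p q)

-- Graphs of connectivity three

three-elements : ∀ {n} {S : Subset n} {u v w} → u ≢ v → w ≢ u → w ≢ v →
  u ∈ S → v ∈ S → w ∈ S → 3 ℕ.≤ ∣ S ∣
three-elements u≢v w≢u w≢v u∈S v∈S w∈S =
  ℕₚ.≤-trans (s≤s (ℕₚ.≤-trans (s≤s (ℕₚ.≤-trans (s≤s z≤n)
    (x∈p⇒∣p-x∣<∣p∣ (x∈p∧x≢y⇒x∈p-y (x∈p∧x≢y⇒x∈p-y w∈S w≢u) w≢v))))
    (x∈p⇒∣p-x∣<∣p∣ (x∈p∧x≢y⇒x∈p-y v∈S (≢-sym u≢v)))))
    (x∈p⇒∣p-x∣<∣p∣ u∈S)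

module _ (G : Graph) (three-connected : 3 -Connected G) where
  open Graph G

  three-connected⇒connected : Connected
  three-connected⇒connected u v = Star.map (λ (_ , _ , uv) → uv)
    (proj₂ three-connected _ (subst (ℕ._< 3) (sym (∣⊥∣≡0 order)) (s≤s z≤n)) ∉⊥ ∉⊥)

  neighbour : ∀ {u v} → v ∈ tabulate (adj u) → Adj u v
  neighbour {u} {v} v∈ = Equivalence.from T-≡ (trans (sym (lookup∘tabulate (adj u) v)) ([]=⇒lookup v∈))

  neighbour⁻¹ : ∀ {u v} → Adj u v → v ∈ tabulate (adj u)
  neighbour⁻¹ {u} {v} uv = lookup⇒[]= v _ (trans (lookup∘tabulate (adj u) v) (Equivalence.to T-≡ uv))

  -- Otherwise deleting the neighbours of u would isolate u.
  3≤degree : ∀ u → 3 ℕ.≤ degree u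
  3≤degree u = ℕₚ.≮⇒≥ λ degree<3 → case (Finₚ.any? λ v → ¬? (v ∈? N) ×-dec ¬? (v Fin.≟ u)) of λ where
      (yes (v , v∉N , v≢u)) → isolated v≢u (proj₂ three-connected N degree<3 u∉N v∉N)
      -- Here `u` is adjacent to all other vertices, so there are at most `degree u + 1`, that is at
      -- most three, vertices in all.
      (no none) → ℕₚ.<⇒≱
        (ℕₚ.m+n≤o⇒m≤o∸n 2 (ℕₚ.≤-trans (ℕₚ.+-monoʳ-≤ 2 (ℕₚ.≤-pred degree<3)) (proj₁ three-connected)))
        (crowded λ {v} v∉N → decidable-stable (v Fin.≟ u) λ v≢u → none (v , v∉N , v≢u))
    where
    N : Subset order
    N = tabulate (adj u)

    u∉N : u ∉ N
    u∉N u∈N = irreflexive (neighbour u∈N)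

    isolated : ∀ {v} → v ≢ u → ¬ Star (λ a b → a ∉ N × b ∉ N × Adj a b) u v
    isolated v≢u ε                      = v≢u refl
    isolated v≢u ((_ , w∉N , uw) ◅ _) = w∉N (neighbour⁻¹ uw)

    crowded : (∀ {v} → v ∉ N → v ≡ u) → order ℕ.∸ degree u ℕ.≤ 1
    crowded only = subst₂ ℕ._≤_ (∣∁p∣≡n∸∣p∣ N) (∣⁅x⁆∣≡1 u)
      (p⊆q⇒∣p∣≤∣q∣ λ {v} v∈ → subst (_∈ ⁅ u ⁆) (sym (only (x∈∁p⇒x∉p v∈))) (x∈⁅x⁆ u))

sum-bound : ∀ {n} (g : Fin n → ℕ) m → (∀ i → m ℕ.≤ g i) → n ℕ.* m ℕ.≤ sum (tabulate g)
sum-bound {zero}  g m m≤g = z≤n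
sum-bound {suc n} g m m≤g = ℕₚ.+-mono-≤ (m≤g zero) (sum-bound (g ∘ suc) m (m≤g ∘ suc))

order≤2faceCount : (M : PlaneGraph) → 3 -Connected PlaneGraph.graph M →
  PlaneGraph.order M ℕ.≤ 2 ℕ.* PlaneGraph.faceCount M
order≤2faceCount M three-connected = ℕₚ.+-cancelˡ-≤ (2 ℕ.* order) _ _ $ begin
  2 ℕ.* order ℕ.+ order         ≡⟨ triple order ⟩
  order ℕ.* 3                   ≤⟨ sum-bound degree 3 (3≤degree graph three-connected) ⟩
  degreeSum                     ≤⟨ ℕₚ.m≤m+n degreeSum 4 ⟩
  degreeSum ℕ.+ 4               ≡⟨ sym euler ⟩
  2 ℕ.* order ℕ.+ 2 ℕ.* faceCount ∎
  where
  open PlaneGraph M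
  open ℕₚ.≤-Reasoning

  triple : ∀ v → 2 ℕ.* v ℕ.+ v ≡ v ℕ.* 3
  triple = solve-∀

-- Realisation of dart maps as plane graphs

-- A plane graph on arbitrary finite types of vertices V and darts D: φ moves a dart forward
-- along the walk of its face, so φ ∘ rev turns around its tail.
record DartMap (p q f : ℕ) : Set₁ where
  field
    V D    : Set
    V↔     : V ↔ Fin p
    D↔     : D ↔ Fin q
    tail   : D → V
    rev    : D → D
    φ φ⁻¹  : D → D
    rev-rev : ∀ d → rev (rev d) ≡ d
    φ⁻¹-φ  : ∀ d → φ⁻¹ (φ d) ≡ d

  head : D → V
  head d = tail (rev d)

  turn : D → D
  turn d = φ (rev d)

  field
    tail-turn : ∀ d → tail (turn d) ≡ tail d
    loopless  : ∀ d → head d ≢ tail d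
    simple    : ∀ {d e} → tail d ≡ tail e → head d ≡ head e → d ≡ e
    anchor    : V → D
    reach-anchor : ∀ d → Reach turn d (anchor (tail d))
    face      : D → Fin f
    face-φ    : ∀ d → face (φ d) ≡ face d
    base      : Fin f → D
    face-base : ∀ i → face (base i) ≡ i
    reach-base : ∀ d → Reach φ (base (face d)) d
    euler     : 2 ℕ.* p ℕ.+ 2 ℕ.* f ≡ q ℕ.+ 4

  Edge : V → V → Set
  Edge u v = ∃[ d ] (tail d ≡ u × head d ≡ v)

  -- Bad is a set of at most two vertices.
  Robust : Set₁
  Robust = (Bad : V → Set) → (∀ v → Dec (Bad v)) →
    (∀ {u v w} → u ≢ v → w ≢ u → w ≢ v → Bad u → Bad v → ¬ Bad w) →
    ∀ {u v} → ¬ Bad u → ¬ Bad v → Star (λ u v → ¬ Bad u × ¬ Bad v × Edge u v) u v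

  φ-injective : Injective _≡_ _≡_ φ
  φ-injective {d} {e} eq = trans (sym (φ⁻¹-φ d)) (trans (cong φ⁻¹ eq) (φ⁻¹-φ e))

  turn-injective : Injective _≡_ _≡_ turn
  turn-injective {d} {e} eq = trans (sym (rev-rev d)) (trans (cong rev (φ-injective eq)) (rev-rev e))

  tail-φ : ∀ d → tail (φ d) ≡ head d
  tail-φ d = trans (cong (tail ∘ φ) (sym (rev-rev d))) (tail-turn (rev d))

  -- Reaching the common `anchor` suffices, because `turn` permutes a finite set and the way from
  -- `e` to the anchor can be reversed.
  reach-turn : ∀ {d e} → tail d ≡ tail e → Reach turn d e
  reach-turn {d} {e} eq = reach-trans (reach-anchor d)
    (FiniteDynamics.reach-sym D↔ turn turn-injective
      (subst (λ v → Reach turn e (anchor v)) (sym eq) (reach-anchor e)))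

module Realise {p q f} (M : DartMap p q f) where
  open DartMap M
  open Inverse V↔ public using ()
    renaming (to to vertex; from to vertex⁻¹; strictlyInverseʳ to vertex⁻¹-vertex; strictlyInverseˡ to vertex-vertex⁻¹)
  open Inverse D↔ using () renaming (to to index; from to index⁻¹; strictlyInverseʳ to index⁻¹-index)

  vertex-injective : Injective _≡_ _≡_ vertex
  vertex-injective eq = trans (sym (vertex⁻¹-vertex _)) (trans (cong vertex⁻¹ eq) (vertex⁻¹-vertex _))

  abstract
    adjacency : Fin p → Fin p → Bool
    adjacency u v = ⌊ Finₚ.any? (λ i → (vertex (tail (index⁻¹ i)) Fin.≟ u) ×-dec (vertex (head (index⁻¹ i)) Fin.≟ v)) ⌋

    lift : ∀ {u v} → T (adjacency u v) → ∃[ d ] (vertex (tail d) ≡ u × vertex (head d) ≡ v)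
    lift uv with toWitness uv
    ... | i , t , h = index⁻¹ i , t , h

    edge : ∀ d → T (adjacency (vertex (tail d)) (vertex (head d)))
    edge d = fromWitness (index d , cong (vertex ∘ tail) (index⁻¹-index d) , cong (vertex ∘ head) (index⁻¹-index d))

  realGraph : Graph
  realGraph = record
    { order       = p
    ; adj         = adjacency
    ; symmetric   = λ uv → let d , t , h = lift uv in
        subst₂ (λ u v → T (adjacency u v)) h (trans (cong (vertex ∘ tail) (rev-rev d)) t) (edge (rev d))
    ; irreflexive = λ vv → let d , t , h = lift vv in loopless d (vertex-injective (trans h (sym t)))
    }

  open Graph realGraph hiding (order)

  rotation : Fin p → Fin p → Fin p
  rotation u v with T? (adjacency u v)
  ... | yes uv = vertex (head (turn (proj₁ (lift uv))))
  -- A default: only the rotation of neighbours matters.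
  ... | no _   = v

  lift-unique : ∀ {u v} (uv : Adj u v) {d} → vertex (tail d) ≡ u → vertex (head d) ≡ v → proj₁ (lift uv) ≡ d
  lift-unique uv t h = let d , t′ , h′ = lift uv in
    simple (vertex-injective (trans t′ (sym t))) (vertex-injective (trans h′ (sym h)))

  rotation-turn : ∀ {u v d} → vertex (tail d) ≡ u → vertex (head d) ≡ v → rotation u v ≡ vertex (head (turn d))
  rotation-turn {u} {v} {d} t h with T? (adjacency u v)
  ... | yes uv = cong (vertex ∘ head ∘ turn) (lift-unique uv t h)
  ... | no ¬uv = contradiction (subst₂ Adj t h (edge d)) ¬uv

  tail-fold-turn : ∀ d k → tail (fold d turn k) ≡ tail d
  tail-fold-turn d zero    = refl
  tail-fold-turn d (suc k) = trans (tail-turn _) (tail-fold-turn d k)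

  fold-rotation : ∀ d k → fold (vertex (head d)) (rotation (vertex (tail d))) k ≡ vertex (head (fold d turn k))
  fold-rotation d zero    = refl
  fold-rotation d (suc k) = trans (cong (rotation _) (fold-rotation d k))
    (rotation-turn (cong vertex (tail-fold-turn d k)) refl)

  rotation-adj : ∀ {u v} → Adj u v → Adj u (rotation u v)
  rotation-adj uv = let d , t , h = lift uv in
    subst₂ Adj (trans (cong vertex (tail-turn d)) t) (sym (rotation-turn t h)) (edge (turn d))

  rotation-cyclic : ∀ {u v w} → Adj u v → Adj u w → ∃[ k ] fold v (rotation u) k ≡ w
  rotation-cyclic uv uw with lift uv | lift uw
  ... | d , refl , refl | e , t , refl with reach-turn {d} {e} (vertex-injective (sym t))
  ...   | k , refl = k , fold-rotation d k

  toDart : D → Dart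
  toDart d = dart (edge d)

  fromDart : Dart → D
  fromDart (dart uv) = proj₁ (lift uv)

  toDart-fromDart : ∀ d → toDart (fromDart d) ≡ d
  toDart-fromDart (dart uv) = let _ , t , h = lift uv in dart-≡ realGraph t h

  fromDart-toDart : ∀ d → fromDart (toDart d) ≡ d
  fromDart-toDart d = lift-unique (edge d) refl refl

  toDart-injective : Injective _≡_ _≡_ toDart
  toDart-injective eq = trans (sym (fromDart-toDart _)) (trans (cong fromDart eq) (fromDart-toDart _))

  q≡degreeSum : q ≡ degreeSum
  q≡degreeSum = ↔⇒≡ (darts-↔ realGraph ↔-∘ (mk↔ₛ′ toDart fromDart toDart-fromDart fromDart-toDart ↔-∘ ↔-sym D↔))

  -- A copy of `faceStep`, needed because the faces have to be described before the plane graph that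
  -- contains them is there.
  step : Dart → Dart
  step (dart uv) = dart (rotation-adj (symmetric uv))

  -- On the reversed dart the rotation acts as `turn`, and `turn (rev d)` is `φ d` since `rev` is an
  -- involution. Hence the faces are the orbits of `φ`.
  step-toDart : ∀ d → step (toDart d) ≡ toDart (φ d)
  step-toDart d = dart-≡ realGraph (cong vertex (sym (tail-φ d)))
    (trans (rotation-turn refl (cong (vertex ∘ tail) (rev-rev d))) (cong (vertex ∘ head ∘ φ) (rev-rev d)))

  fold-step-toDart : ∀ d k → fold (toDart d) step k ≡ toDart (fold d φ k)
  fold-step-toDart d zero    = refl
  fold-step-toDart d (suc k) = trans (cong step (fold-step-toDart d k)) (step-toDart (fold d φ k))

  faceOf : Dart → Fin f
  faceOf d = face (fromDart d)

  fromDart-step : ∀ d → fromDart (step d) ≡ φ (fromDart d)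
  fromDart-step d = trans (cong (fromDart ∘ step) (sym (toDart-fromDart d)))
    (trans (cong fromDart (step-toDart (fromDart d))) (fromDart-toDart _))

  faceOf-cong : ∀ {d e} → EqClosure (λ d e → step d ≡ e) d e → faceOf d ≡ faceOf e
  faceOf-cong = EqClosure.gfold isEquivalence faceOf
    λ { {d} refl → sym (trans (cong face (fromDart-step d)) (face-φ _)) }

  reach⇒sameFace : ∀ {d e} → Reach step d e → EqClosure (λ d e → step d ≡ e) d e
  reach⇒sameFace (zero  , refl) = ε
  reach⇒sameFace (suc k , refl) = reach⇒sameFace (k , refl) ◅◅ (fwd refl ◅ ε)

  sameFace-base : ∀ d → EqClosure (λ d e → step d ≡ e) (toDart (base (faceOf d))) d
  sameFace-base d with reach-base (fromDart d)
  ... | k , eq = reach⇒sameFace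
    (k , trans (fold-step-toDart _ k) (trans (cong toDart eq) (toDart-fromDart d)))

  module _ (graph-connected : Connected) where

    realPlaneGraph : PlaneGraph
    realPlaneGraph = record
      { graph      = realGraph
      ; connected  = graph-connected
      ; rot        = rotation
      ; rot-adj    = rotation-adj
      ; rot-cyclic = rotation-cyclic
      ; faceCount  = f
      ; faces      = record
          { to        = faceOf
          ; from      = toDart ∘ base
          ; to-cong   = faceOf-cong
          ; from-cong = λ { refl → ε }
          ; inverse   =
              (λ {i} eq → trans (faceOf-cong eq) (trans (cong face (fromDart-toDart (base i))) (face-base i)))
            , (λ { {d} refl → sameFace-base d })
          }
      ; euler      = trans euler (cong (ℕ._+ 4) q≡degreeSum)
      }

    open PlaneGraph realPlaneGraph using (FaceLength; SameFace; walk)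

    faceLength : ∀ {d m} → OrbitLength φ d m → FaceLength (toDart d) m
    faceLength {d} {m} (0<m , closed , minimal) = 0<m
      , trans (fold-step-toDart d m) (cong toDart closed)
      , λ j 0<j j<m eq → minimal j 0<j j<m (toDart-injective (trans (sym (fold-step-toDart d j)) eq))

    sameFace : ∀ {d e} → face d ≡ face e → SameFace (toDart d) (toDart e)
    sameFace {d} {e} eq = EqClosure.symmetric _ (toBase d) ◅◅
      subst (λ i → SameFace (toDart (base i)) (toDart e)) (sym eq) (toBase e)
      where
      toBase : ∀ d → SameFace (toDart (base (face d))) (toDart d)
      toBase d = let k , eq = reach-base d in reach⇒sameFace (k , trans (fold-step-toDart _ k) (cong toDart eq))

    realPentagulation : ∀ {n} outer → 3 ℕ.≤ n → OrbitLength φ outer n →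
      Injective _≡_ _≡_ (λ (i : Fin n) → tail (fold outer φ (toℕ i))) →
      (∀ d → face outer ≢ face d → OrbitLength φ d 5) → Pentagulation n
    realPentagulation {n} outer 3≤n outer-length outer-cycle pentagonal = record
      { planeGraph   = realPlaneGraph
      ; 3≤n          = 3≤n
      ; outer        = toDart outer
      ; outer-length = faceLength {outer} {n} outer-length
      ; outer-cycle  = λ {i} {j} eq → outer-cycle (vertex-injective
          (trans (sym (tail-walk (toℕ i))) (trans eq (tail-walk (toℕ j)))))
      ; pentagonal   = λ d other → subst (λ d → FaceLength d 5) (toDart-fromDart d)
          (faceLength {fromDart d} {5} (pentagonal (fromDart d) λ eq →
            other (subst (SameFace (toDart outer)) (toDart-fromDart d) (sameFace {outer} {fromDart d} eq))))
      }
      where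
      tail-walk : ∀ j → Dart.tail (walk (toDart outer) j) ≡ vertex (tail (fold outer φ j))
      tail-walk j = cong Dart.tail (fold-step-toDart outer j)

  module _ (3<p : 3 ℕ.< p) (robust : Robust) where

    connectedWithout : ∀ S → ∣ S ∣ ℕ.< 3 → ConnectedWithout S
    connectedWithout S ∣S∣<3 {u} {v} u∉S v∉S =
      subst₂ (Star _) (vertex-vertex⁻¹ u) (vertex-vertex⁻¹ v) $
      Star.gmap vertex (λ (gu , gv , d , t , h) → gu , gv , subst₂ Adj (cong vertex t) (cong vertex h) (edge d)) $
      robust (λ v → vertex v ∈ S) (λ v → vertex v ∈? S)
        (λ u≢v w≢u w≢v u∈S v∈S w∈S → ℕₚ.<⇒≱ ∣S∣<3 (three-elements
          (u≢v ∘ vertex-injective) (w≢u ∘ vertex-injective) (w≢v ∘ vertex-injective) u∈S v∈S w∈S))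
        (u∉S ∘ subst (_∈ S) (vertex-vertex⁻¹ u)) (v∉S ∘ subst (_∈ S) (vertex-vertex⁻¹ v))

    threeConnected : 3 -Connected realGraph
    threeConnected = 3<p , connectedWithout

    graph-connected : Connected
    graph-connected = three-connected⇒connected realGraph threeConnected

-- Exhaustive search

Searchable : Set → Set₁
Searchable A = ∀ {P : A → Set} → (∀ x → Dec (P x)) → Dec (∃ P)

search-Bool : Searchable Bool
search-Bool P? = map′ (λ { (inj₁ p) → true , p ; (inj₂ p) → false , p })
  (λ { (true , p) → inj₁ p ; (false , p) → inj₂ p }) (P? true ⊎-dec P? false)

search-× : ∀ {A B} → Searchable A → Searchable B → Searchable (A × B)
search-× searchA searchB P? = map′ (λ (x , y , p) → (x , y) , p) (λ ((x , y) , p) → x , y , p)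
  (searchA λ x → searchB λ y → P? (x , y))

search-Vec : ∀ {A} n → Searchable A → Searchable (Vec A n)
search-Vec zero    search P? = map′ ([] ,_) (λ { ([] , p) → p }) (P? [])
search-Vec (suc n) search P? = map′ (λ ((x , xs) , p) → x ∷ xs , p) (λ { (x ∷ xs , p) → (x , xs) , p })
  (search-× search (search-Vec n search) λ (x , xs) → P? (x ∷ xs))

all-subsets? : ∀ {n} {P : Subset n → Set} → (∀ S → Dec (P S)) → Dec (∀ S → P S)
all-subsets? P? = map′ (λ none S → decidable-stable (P? S) λ ¬p → none (S , ¬p))
  (λ all (S , ¬p) → ¬p (all S)) (¬? (anySubset? (λ S → ¬? (P? S))))

orbitLength? : ∀ {A : Set} → DecidableEquality A → (f : A → A) → ∀ x m → Dec (OrbitLength f x m)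
orbitLength? _≟_ f x m = (0 ℕₚ.<? m) ×-dec (fold x f m ≟ x) ×-dec
    map′ minimal minimal⁻¹ (ℕₚ.allUpTo? (λ j → (0 ℕₚ.<? j) →-dec ¬? (fold x f j ≟ x)) m)
  where
  minimal : (∀ {j} → j ℕ.< m → 0 ℕ.< j → fold x f j ≢ x) → ∀ j → 0 ℕ.< j → j ℕ.< m → fold x f j ≢ x
  minimal all j 0<j j<m = all j<m 0<j

  minimal⁻¹ : (∀ j → 0 ℕ.< j → j ℕ.< m → fold x f j ≢ x) → ∀ {j} → j ℕ.< m → 0 ℕ.< j → fold x f j ≢ x
  minimal⁻¹ all j<m 0<j = all _ 0<j j<m

-- Warshall's algorithm: Via xs x y says that R leads from x to y through vertices among xs.
module Warshall {A : Set} (_≟_ : DecidableEquality A) {R : Rel A Level.zero} (R? : ∀ x y → Dec (R x y)) where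

  Via : List A → A → A → Set
  Via []       x y = x ≡ y ⊎ R x y
  Via (p ∷ ps) x y = Via ps x y ⊎ (Via ps x p × Via ps p y)

  via? : ∀ ps x y → Dec (Via ps x y)
  via? []       x y = (x ≟ y) ⊎-dec R? x y
  via? (p ∷ ps) x y = via? ps x y ⊎-dec (via? ps x p ×-dec via? ps p y)

  via⇒star : ∀ ps {x y} → Via ps x y → Star R x y
  via⇒star []       (inj₁ refl)    = ε
  via⇒star []       (inj₂ xy)      = xy ◅ ε
  via⇒star (p ∷ ps) (inj₁ v)       = via⇒star ps v
  via⇒star (p ∷ ps) (inj₂ (v , w)) = via⇒star ps v ◅◅ via⇒star ps w

  direct : ∀ ps {x y} → x ≡ y ⊎ R x y → Via ps x y
  direct []       e = e
  direct (p ∷ ps) e = inj₁ (direct ps e)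

  -- If `p` is the head, a leg that ends or begins at `p` does not need it as an intermediate
  -- vertex. If `p` comes later and both legs pass through the head, the loop from the head through
  -- `p` back to it is cut out. This absorbs paths of any length.
  via-trans : ∀ ps {p x y} → p Listₘ.∈ ps → Via ps x p → Via ps p y → Via ps x y
  via-trans (p ∷ ps) (here refl) v w = inj₂ (toHead v , fromHead w)
    where
    toHead : ∀ {x} → Via (p ∷ ps) x p → Via ps x p
    toHead (inj₁ v)       = v
    toHead (inj₂ (v , _)) = v

    fromHead : ∀ {y} → Via (p ∷ ps) p y → Via ps p y
    fromHead (inj₁ w)       = w
    fromHead (inj₂ (_ , w)) = w
  via-trans (_ ∷ ps) (there p∈) (inj₁ v)       (inj₁ w)        = inj₁ (via-trans ps p∈ v w)
  via-trans (_ ∷ ps) (there p∈) (inj₁ v)       (inj₂ (w , w′)) = inj₂ (via-trans ps p∈ v w , w′)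
  via-trans (_ ∷ ps) (there p∈) (inj₂ (v , v′)) (inj₁ w)       = inj₂ (v , via-trans ps p∈ v′ w)
  via-trans (_ ∷ ps) (there p∈) (inj₂ (v , v′)) (inj₂ (w , w′)) = inj₂ (v , w′)

  module _ {ps : List A} (complete : ∀ x → x Listₘ.∈ ps) where

    star⇒via : ∀ {x y} → Star R x y → Via ps x y
    star⇒via ε         = direct ps (inj₁ refl)
    star⇒via (xy ◅ yz) = via-trans ps (complete _) (direct ps (inj₂ xy)) (star⇒via yz)

    star? : ∀ x y → Dec (Star R x y)
    star? x y = map′ (via⇒star ps) star⇒via (via? ps x y)

symClosure? : ∀ {A : Set} {R : Rel A Level.zero} → (∀ x y → Dec (R x y)) → ∀ x y → Dec (SymClosure R x y)
symClosure? R? x y = map′ (λ { (inj₁ xy) → fwd xy ; (inj₂ yx) → bwd yx })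
  (λ { (fwd xy) → inj₁ xy ; (bwd yx) → inj₂ yx }) (R? x y ⊎-dec R? y x)

reach⇒star : ∀ {A : Set} {f : A → A} {x y} → Reach f x y → Star (λ x y → f x ≡ y) x y
reach⇒star (zero  , refl) = ε
reach⇒star (suc k , refl) = reach⇒star (k , refl) ◅◅ (refl ◅ ε)

star⇒reach : ∀ {A : Set} {f : A → A} {x y} → Star (λ x y → f x ≡ y) x y → Reach f x y
star⇒reach ε           = 0 , refl
star⇒reach (refl ◅ yz) = reach-trans (1 , refl) (star⇒reach yz)

-- Deciding the existence of pentagulations

-- An arc is a pair of vertices, and a dart when the pair is adjacent.  The function label gives the face of
-- an arc and base a dart in each face.
module Encoding (n N F : ℕ) where

  Arc : Set
  Arc = Fin N × Fin N

  _≟ᵃ_ : DecidableEquality Arc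
  _≟ᵃ_ = ≡-dec Fin._≟_ Fin._≟_

  allArcs : ∀ x → x Listₘ.∈ cartesianProduct (allFin N) (allFin N)
  allArcs (u , v) = ∈-cartesianProduct⁺ (∈-allFin u) (∈-allFin v)

  module _ (A : Fin N → Fin N → Bool) (R : Fin N → Fin N → Fin N) where

    IsDart : Arc → Set
    IsDart (u , v) = T (A u v)

    isDart? : ∀ x → Dec (IsDart x)
    isDart? (u , v) = T? (A u v)

    step : Arc → Arc
    step (u , v) = v , R v u

    -- `step` acts on all pairs of vertices, adjacent or not; with the adjacency recorded, a chain
    -- of arcs can be lifted to a chain of darts.
    Step : Rel Arc Level.zero
    Step x y = IsDart x × step x ≡ y

    all-darts? : {P : Arc → Set} → (∀ x → Dec (P x)) → Dec (∀ u v → T (A u v) → P (u , v))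
    all-darts? P? = Finₚ.all? λ u → Finₚ.all? λ v → T? (A u v) →-dec P? (u , v)

    -- A 3-connected pentagulation in decidable terms: each field quantifies over finite sets,
    -- compares elements or asks for a path in a finite graph. So `rot-cyclic` speaks of a `Star`
    -- instead of an unbounded exponent, and `label`, `base` and `connect-base` stand for the
    -- bijection between faces and `Fin F`.
    record Valid (label : Arc → Fin F) (base : Fin F → Arc) (outer : Arc) : Set where
      field
        symmetric    : ∀ u v → T (A u v) → T (A v u)
        irreflexive  : ∀ v → ¬ T (A v v)
        rot-adj      : ∀ u v → T (A u v) → T (A u (R u v))
        rot-cyclic   : ∀ u v → T (A u v) → ∀ w → T (A u w) → Star (λ x y → R u x ≡ y) v w
        label-step   : ∀ u v → T (A u v) → label (step (u , v)) ≡ label (u , v)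
        base-dart    : ∀ f → IsDart (base f)
        label-base   : ∀ f → label (base f) ≡ f
        connect-base : ∀ u v → T (A u v) → EqClosure Step (base (label (u , v))) (u , v)
        euler        : 2 ℕ.* N ℕ.+ 2 ℕ.* F ≡ sum (tabulate λ u → ∣ tabulate (A u) ∣) ℕ.+ 4
        3≤n          : 3 ℕ.≤ n
        outer-dart   : IsDart outer
        outer-length : OrbitLength step outer n
        outer-cycle  : ∀ (i j : Fin n) → proj₁ (fold outer step (toℕ i)) ≡ proj₁ (fold outer step (toℕ j)) → i ≡ j
        pentagonal   : ∀ u v → T (A u v) → label outer ≢ label (u , v) → OrbitLength step (u , v) 5
        3<N          : 3 ℕ.< N
        robust       : ∀ S → ∣ S ∣ ℕ.< 3 → ∀ u → u ∉ S → ∀ v → v ∉ S →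
                       Star (λ a b → a ∉ S × b ∉ S × T (A a b)) u v

    valid? : ∀ label base outer → Dec (Valid label base outer)
    valid? label base outer = map′
      (λ (p₁ , p₂ , p₃ , p₄ , p₅ , p₆ , p₇ , p₈ , p₉ , p₁₀ , p₁₁ , p₁₂ , p₁₃ , p₁₄ , p₁₅ , p₁₆) → record
        { symmetric = p₁ ; irreflexive = p₂ ; rot-adj = p₃ ; rot-cyclic = p₄ ; label-step = p₅ ; base-dart = p₆
        ; label-base = p₇ ; connect-base = p₈ ; euler = p₉ ; 3≤n = p₁₀ ; outer-dart = p₁₁ ; outer-length = p₁₂
        ; outer-cycle = p₁₃ ; pentagonal = p₁₄ ; 3<N = p₁₅ ; robust = p₁₆ })
      (λ v → Valid.symmetric v , Valid.irreflexive v , Valid.rot-adj v , Valid.rot-cyclic v , Valid.label-step v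
        , Valid.base-dart v , Valid.label-base v , Valid.connect-base v , Valid.euler v , Valid.3≤n v
        , Valid.outer-dart v , Valid.outer-length v , Valid.outer-cycle v , Valid.pentagonal v , Valid.3<N v
        , Valid.robust v)
      ( all-darts? (λ (u , v) → T? (A v u))
      ×-dec Finₚ.all? (λ v → ¬? (T? (A v v)))
      ×-dec all-darts? (λ (u , v) → T? (A u (R u v)))
      ×-dec all-darts? (λ (u , v) → Finₚ.all? λ w → T? (A u w) →-dec
              Warshall.star? Fin._≟_ (λ x y → R u x Fin.≟ y) ∈-allFin v w)
      ×-dec all-darts? (λ x → label (step x) Fin.≟ label x)
      ×-dec Finₚ.all? (λ f → isDart? (base f))
      ×-dec Finₚ.all? (λ f → label (base f) Fin.≟ f)
      ×-dec all-darts? (λ x → Warshall.star? _≟ᵃ_ (symClosure? λ x y → isDart? x ×-dec (step x ≟ᵃ y)) allArcs (base (label x)) x)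
      ×-dec (_ ℕ.≟ _)
      ×-dec (3 ℕ.≤? n)
      ×-dec isDart? outer
      ×-dec orbitLength? _≟ᵃ_ step outer n
      ×-dec Finₚ.all? (λ i → Finₚ.all? λ j → (_ Fin.≟ _) →-dec (i Fin.≟ j))
      ×-dec all-darts? (λ x → ¬? (label outer Fin.≟ label x) →-dec orbitLength? _≟ᵃ_ step x 5)
      ×-dec (3 ℕₚ.<? N)
      ×-dec all-subsets? (λ S → (∣ S ∣ ℕₚ.<? 3) →-dec Finₚ.all? λ u → ¬? (u ∈? S) →-dec Finₚ.all? λ v → ¬? (v ∈? S) →-dec
              Warshall.star? Fin._≟_ (λ a b → ¬? (a ∈? S) ×-dec ¬? (b ∈? S) ×-dec T? (A a b)) ∈-allFin u v))

  module Decode {A : Fin N → Fin N → Bool} {R : Fin N → Fin N → Fin N} {label : Arc → Fin F} {base : Fin F → Arc}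
                {outer : Arc} (valid : Valid A R label base outer) where

    open Valid valid

    decodedGraph : Graph
    decodedGraph = record
      { order       = N
      ; adj         = A
      ; symmetric   = λ {u} {v} → symmetric u v
      ; irreflexive = λ {v} → irreflexive v
      }

    open Graph decodedGraph using (Dart; dart; Adj)

    three-connected : 3 -Connected decodedGraph
    three-connected = 3<N , λ S ∣S∣<3 u∉S v∉S → robust S ∣S∣<3 _ u∉S _ v∉S

    fromArc : ∀ x → IsDart A R x → Dart
    fromArc (u , v) uv = dart uv

    arc : Dart → Arc
    arc d = Dart.tail d , Dart.head d

    arc-injective : ∀ {d e} → arc d ≡ arc e → d ≡ e
    arc-injective eq = dart-≡ decodedGraph (cong proj₁ eq) (cong proj₂ eq)

    faceStep : Dart → Dart
    faceStep (dart {u} {v} uv) = dart (rot-adj v u (symmetric u v uv))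

    arc-fold : ∀ d k → arc (fold d faceStep k) ≡ fold (arc d) (step A R) k
    arc-fold d zero    = refl
    arc-fold d (suc k) = cong (step A R) (arc-fold d k)

    SameFace : Rel Dart Level.zero
    SameFace = EqClosure (λ d e → faceStep d ≡ e)

    -- A forward step stays among darts by `rot-adj`; for a backward step the adjacency of the new
    -- arc comes from `Step` itself.
    lift-face : ∀ {x y} → EqClosure (Step A R) x y → ∀ {d e} → arc d ≡ x → arc e ≡ y → SameFace d e
    lift-face ε {d} {e} refl eq with refl ← arc-injective {d} {e} (sym eq) = ε
    lift-face (fwd (_ , refl) ◅ rest) {d} refl eq = fwd refl ◅ lift-face rest refl eq
    lift-face (bwd (x , refl) ◅ rest) {d} d≡ eq =
      bwd {b = fromArc _ x} (arc-injective (sym d≡)) ◅ lift-face rest refl eq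

    decodedPlaneGraph : PlaneGraph
    decodedPlaneGraph = record
      { graph      = decodedGraph
      ; connected  = three-connected⇒connected decodedGraph three-connected
      ; rot        = R
      ; rot-adj    = λ {u} {v} → rot-adj u v
      ; rot-cyclic = λ {u} {v} {w} uv uw → star⇒reach (rot-cyclic u v uv w uw)
      ; faceCount  = F
      ; faces      = record
          { to        = label ∘ arc
          ; from      = base-face
          ; to-cong   = label-cong
          ; from-cong = λ { refl → ε }
          ; inverse   = (λ {f} eq → trans (label-cong eq) (label-base f))
                      , (λ { {dart {u} {v} uv} refl → lift-face (connect-base u v uv) refl refl })
          }
      ; euler      = euler
      }
      where
      base-face : Fin F → Dart
      base-face f = fromArc (base f) (base-dart f)

      label-cong : ∀ {d e} → SameFace d e → label (arc d) ≡ label (arc e)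
      label-cong = EqClosure.gfold isEquivalence (label ∘ arc) λ { {dart {u} {v} uv} refl → sym (label-step u v uv) }

    open PlaneGraph decodedPlaneGraph using (FaceLength)

    decodeLength : ∀ d m → OrbitLength (step A R) (arc d) m → FaceLength d m
    decodeLength d m (0<m , closed , minimal) = 0<m , arc-injective (trans (arc-fold d m) closed)
      , λ j 0<j j<m eq → minimal j 0<j j<m (trans (sym (arc-fold d j)) (cong arc eq))

    decoded : Pentagulation n
    decoded = record
      { planeGraph   = decodedPlaneGraph
      ; 3≤n          = 3≤n
      ; outer        = outer-face
      ; outer-length = decodeLength outer-face n outer-length
      ; outer-cycle  = λ {i} {j} eq → outer-cycle i j (trans (sym (cong proj₁ (arc-fold outer-face (toℕ i))))
                         (trans eq (cong proj₁ (arc-fold outer-face (toℕ j)))))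
      ; pentagonal   = λ { d@(dart {u} {v} uv) other → decodeLength d 5 (pentagonal u v uv λ eq →
                         other (same-label eq)) }
      }
      where
      outer-face : Dart
      outer-face = fromArc outer outer-dart

      same-label : ∀ {d} → label outer ≡ label (arc d) → SameFace outer-face d
      same-label {dart {u} {v} uv} eq =
        EqClosure.symmetric _ (lift-face (connect-base _ _ outer-dart) {d = fromArc _ (base-dart _)} refl refl) ◅◅
        lift-face (connect-base u v uv) (cong base eq) refl

module Encode {n} (𝒫 : Pentagulation n) (three-connected : 3 -Connected Pentagulation.graph 𝒫) where
  open Pentagulation 𝒫
  open Encoding n order faceCount using (Arc; IsDart; Step; Valid)
  open Inverse faces renaming (to to toFace; from to fromFace)

  arc : Dart → Arc
  arc d = Dart.tail d , Dart.head d

  -- Functions read off from tables agree with the original ones only pointwise, and labels only on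
  -- darts; hence these four hypotheses in place of the functions themselves.
  module _ {A : Vertex → Vertex → Bool} {R : Vertex → Vertex → Vertex}
           {label : Arc → Fin faceCount} {base : Fin faceCount → Arc}
           (A≡ : ∀ u v → A u v ≡ adj u v) (R≡ : ∀ u v → R u v ≡ rot u v)
           (label≡ : ∀ d → label (arc d) ≡ toFace d) (base≡ : ∀ f → base f ≡ arc (fromFace f)) where

    private
      step = Encoding.step n order faceCount A R

    to-A : ∀ {u v} → Adj u v → T (A u v)
    to-A = subst T (sym (A≡ _ _))

    from-A : ∀ {u v} → T (A u v) → Adj u v
    from-A = subst T (A≡ _ _)

    arc-step : ∀ d → step (arc d) ≡ arc (faceStep d)
    arc-step (dart {u} {v} _) = cong (v ,_) (R≡ v u)

    arc-fold : ∀ d k → fold (arc d) step k ≡ arc (walk d k)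
    arc-fold d zero    = refl
    arc-fold d (suc k) = trans (cong step (arc-fold d k)) (arc-step (walk d k))

    encodeLength : ∀ d m → FaceLength d m → OrbitLength step (arc d) m
    encodeLength d m (0<m , closed , minimal) = 0<m , trans (arc-fold d m) (cong arc closed)
      , λ j 0<j j<m eq → minimal j 0<j j<m (arc-injective (trans (sym (arc-fold d j)) eq))
      where
      arc-injective : ∀ {d e} → arc d ≡ arc e → d ≡ e
      arc-injective eq = dart-≡ graph (cong proj₁ eq) (cong proj₂ eq)

    toFace-step : ∀ d → toFace (faceStep d) ≡ toFace d
    toFace-step d = to-cong (bwd refl ◅ ε)

    encode : Valid A R label base (arc outer)
    encode = record
      { symmetric    = λ u v uv → to-A (symmetric (from-A uv))
      ; irreflexive  = λ v vv → irreflexive (from-A vv)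
      ; rot-adj      = λ u v uv → subst (T ∘ A u) (sym (R≡ u v)) (to-A (rot-adj (from-A uv)))
      ; rot-cyclic   = λ u v uv w uw → Star.map (λ { refl → R≡ u _ }) (reach⇒star (rot-cyclic (from-A uv) (from-A uw)))
      ; label-step   = λ u v uv → let d = dart (from-A uv) in
          trans (cong label (arc-step d)) (trans (label≡ (faceStep d)) (trans (toFace-step d) (sym (label≡ d))))
      ; base-dart    = λ f → subst (IsDart A R) (sym (base≡ f)) (to-A (Dart.adjacent (fromFace f)))
      ; label-base   = λ f → trans (cong label (base≡ f)) (trans (label≡ (fromFace f)) (strictlyInverseˡ f))
      ; connect-base = λ u v uv → let d = dart (from-A uv) in
          subst (λ x → EqClosure (Step A R) x (u , v)) (sym (trans (cong base (label≡ d)) (base≡ (toFace d))))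
            (EqClosure.gmap arc (λ { {d} refl → to-A (Dart.adjacent d) , arc-step d }) (strictlyInverseʳ d))
      ; euler        = trans euler (cong (λ s → s ℕ.+ 4) (cong sum (tabulate-cong λ u →
          cong ∣_∣ (tabulate-cong λ v → sym (A≡ u v)))))
      ; 3≤n          = 3≤n
      ; outer-dart   = to-A (Dart.adjacent outer)
      ; outer-length = encodeLength outer n outer-length
      ; outer-cycle  = λ i j eq → outer-cycle (trans (sym (cong proj₁ (arc-fold outer (toℕ i))))
          (trans eq (cong proj₁ (arc-fold outer (toℕ j)))))
      ; pentagonal   = λ u v uv other → let d = dart (from-A uv) in encodeLength d 5 (pentagonal d λ same →
          other (trans (label≡ outer) (trans (to-cong same) (sym (label≡ d)))))
      ; 3<N          = proj₁ three-connected
      ; robust       = λ S ∣S∣<3 u u∉S v v∉S → Star.map (λ (a∉S , b∉S , ab) → a∉S , b∉S , to-A ab)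
          (proj₂ three-connected S ∣S∣<3 u∉S v∉S)
      }

  -- The label of a pair that is not adjacent is irrelevant.
  label₀ : Vertex → Vertex → Fin faceCount
  label₀ u v with T? (adj u v)
  ... | yes uv = toFace (dart uv)
  ... | no _   = toFace outer

  label₀-dart : ∀ d → label₀ (Dart.tail d) (Dart.head d) ≡ toFace d
  label₀-dart (dart {u} {v} uv) with T? (adj u v)
  ... | yes uv′ = cong toFace (dart-≡ graph refl refl)
  ... | no ¬uv  = contradiction uv ¬uv

-- Tables of finite functions and the search through them

Table : ℕ → Set → Set
Table N B = Vec (Vec B N) N

_!_ : ∀ {N B} → Table N B → Fin N → Fin N → B
(t ! u) v = lookup (lookup t u) v

table : ∀ {N B} → (Fin N → Fin N → B) → Table N B
table f = tabulate (tabulate ∘ f)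

!-table : ∀ {N B} (f : Fin N → Fin N → B) u v → (table f ! u) v ≡ f u v
!-table f u v = trans (cong (λ row → lookup row v) (lookup∘tabulate (tabulate ∘ f) u)) (lookup∘tabulate (f u) v)

search-Table : ∀ {N B} → Searchable B → Searchable (Table N B)
search-Table search = search-Vec _ (search-Vec _ search)

HasPentagons : ℕ → ℕ → Set
HasPentagons n m = ∃ λ (P : Pentagulation n) → 3 -Connected Pentagulation.graph P × Pentagulation.pentagons P ≡ m

module _ (n : ℕ) where
  private
    Code : ℕ → ℕ → Set
    Code N F = Table N Bool × Table N (Fin N) × Table N (Fin F) × Vec (Fin N × Fin N) F × (Fin N × Fin N)

    ValidCode : ∀ N F → Code N F → Set
    ValidCode N F (A , R , label , base , outer) =
      Encoding.Valid n N F (A !_) (R !_) (λ (u , v) → (label ! u) v) (lookup base) outer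

    validCode? : ∀ N F x → Dec (ValidCode N F x)
    validCode? N F (A , R , label , base , outer) = Encoding.valid? n N F (A !_) (R !_) _ _ outer

    search-Code : ∀ N F → Searchable (Code N F)
    search-Code N F = search-× (search-Table search-Bool) $ search-× (search-Table Finₚ.any?) $
      search-× (search-Table Finₚ.any?) $ search-× (search-Vec F (search-× Finₚ.any? Finₚ.any?)) $
      search-× Finₚ.any? Finₚ.any?

    decode : ∀ {N m} → ∃ (ValidCode N (suc m)) → HasPentagons n m
    decode {N} {m} (_ , valid) = decoded , three-connected , refl
      where open Encoding.Decode n N (suc m) valid

    encode : ∀ {m} → HasPentagons n m → ∃ λ (N : Fin (suc (2 ℕ.* suc m))) → ∃ (ValidCode (toℕ N) (suc m))
    encode {m} (P , three-connected , pentagons≡m) =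
        fromℕ< (s≤s bound)
      , subst₂ (λ N F → ∃ (ValidCode N F)) (sym (Finₚ.toℕ-fromℕ< (s≤s bound))) faceCount≡
          ( (table adj , table rot , table label₀ , tabulate (arc ∘ fromFace) , arc outer)
          , Encode.encode P three-connected
              {A = table adj !_} {table rot !_} {λ (u , v) → (table label₀ ! u) v} {lookup (tabulate (arc ∘ fromFace))}
              (!-table adj) (!-table rot)
              (λ d → trans (!-table label₀ (Dart.tail d) (Dart.head d)) (label₀-dart d)) (lookup∘tabulate (arc ∘ fromFace)))
      where
      open Pentagulation P
      open Encode P three-connected using (arc; label₀; label₀-dart)
      open Inverse faces renaming (to to toFace; from to fromFace)

      faceCount≡ : faceCount ≡ suc m
      -- `pred` loses nothing here: the face of `outer` shows that `faceCount` is positive.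
      faceCount≡ = trans (sym (ℕₚ.suc-pred faceCount {{Finₚ.nonZeroIndex (toFace outer)}})) (cong suc pentagons≡m)

      bound : order ℕ.≤ 2 ℕ.* suc m
      bound = subst (λ F → order ℕ.≤ 2 ℕ.* F) faceCount≡ (order≤2faceCount planeGraph three-connected)

  hasPentagons? : ∀ m → Dec (HasPentagons n m)
  hasPentagons? m = map′ (λ (_ , code) → decode code) encode
    (Finₚ.any? λ N → search-Code (toℕ N) (suc m) (validCode? (toℕ N) (suc m)))

-- Existence of the minimum

least : {P : ℕ → Set} → (∀ m → Dec (P m)) → ∀ {m} → P m → ∃[ k ] (k ℕ.≤ m × P k × (∀ j → P j → k ℕ.≤ j))
least {P} P? {m} p = go m p (<-wellFounded m)
  where
  go : ∀ m → P m → Acc ℕ._<_ m → ∃[ k ] (k ℕ.≤ m × P k × (∀ j → P j → k ℕ.≤ j))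
  go m p (acc rs) with ℕₚ.anyUpTo? P? m
  ... | no none = m , ℕₚ.≤-refl , p , λ j q → ℕₚ.≮⇒≥ λ j<m → none (j , j<m , q)
  ... | yes (j , j<m , q) = let k , k≤j , rest = go j q (rs j<m) in k , ℕₚ.≤-trans k≤j (ℕₚ.<⇒≤ j<m) , rest

exists-Pg : ∀ {n m} → HasPentagons n m → ∃[ k ] (IsPg n k × k ℕ.≤ m)
exists-Pg {n} has = let k , k≤m , attained , minimal = least (hasPentagons? n) has in
  k , (attained , λ P connected → minimal _ (P , connected , refl)) , k≤m

-- The wheel

infixr 5 _+↔_
infixr 6 _*↔_

abstract

  _+↔_ : ∀ {A B : Set} {m n} → A ↔ Fin m → B ↔ Fin n → (A ⊎ B) ↔ Fin (m ℕ.+ n)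
  A↔ +↔ B↔ = ↔-sym Finₚ.+↔⊎ ↔-∘ (A↔ ⊎-↔ B↔)

  _*↔_ : ∀ {A B : Set} {m n} → A ↔ Fin m → B ↔ Fin n → (A × B) ↔ Fin (m ℕ.* n)
  A↔ *↔ B↔ = ↔-sym Finₚ.*↔× ↔-∘ (A↔ ×-↔ B↔)

pattern κ i = inj₁ i
pattern ƛ j = inj₂ j

-- The cyclic order of the sectors enters only through `next` and `prev`. The sector `κ i₀`
-- guarantees that `z` lies on the inner walk, and `reach-s₀` that the sectors form a single cycle.
module Wheel (k l : ℕ) (next prev : Fin k ⊎ Fin l → Fin k ⊎ Fin l)
             (next-prev : ∀ s → next (prev s) ≡ s) (prev-next : ∀ s → prev (next s) ≡ s)
             (i₀ : Fin k) (reach-s₀ : ∀ s → Reach prev s (κ i₀)) where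

  Sector : Set
  Sector = Fin k ⊎ Fin l

  s₀ : Sector
  s₀ = κ i₀

  -- Sector κ i consists of the columns c0 to c4, sector ƛ j only of c2 to c4.
  data Column : Set where
    c0 c1    : Fin k → Column
    c2 c3 c4 : Sector → Column

  data V : Set where
    a b c    : Column → V
    d1       : Fin k → V
    d2 d3 d4 : Sector → V
    z        : V

  -- A dart is a face with a position in its boundary walk: O for the outer face, P i and Q i for the
  -- pentagons of the outer and of the inner ring between column i and the next, X s for those around z.
  data D : Set where
    O   : Column → D
    P Q : Column → Fin 5 → D
    X   : Sector → Fin 5 → D

  -- The cycle of columns

  start : Sector → Column
  start (κ i) = c0 i
  start (ƛ j) = c2 (ƛ j)

  right : Column → Column
  right (c0 i) = c1 i
  right (c1 i) = c2 (κ i)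
  right (c2 s) = c3 s
  right (c3 s) = c4 s
  right (c4 s) = start (next s)

  left : Column → Column
  left (c0 i)     = c4 (prev (κ i))
  left (c1 i)     = c0 i
  left (c2 (κ i)) = c1 i
  left (c2 (ƛ j)) = c4 (prev (ƛ j))
  left (c3 s)     = c2 s
  left (c4 s)     = c3 s

  right-left : ∀ i → right (left i) ≡ i
  right-left (c0 i)     = cong start (next-prev (κ i))
  right-left (c1 i)     = refl
  right-left (c2 (κ i)) = refl
  right-left (c2 (ƛ j)) = cong start (next-prev (ƛ j))
  right-left (c3 s)     = refl
  right-left (c4 s)     = refl

  left-start : ∀ s → left (start s) ≡ c4 (prev s)
  left-start (κ i) = refl
  left-start (ƛ j) = refl

  left-right : ∀ i → left (right i) ≡ i
  left-right (c0 i) = refl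
  left-right (c1 i) = refl
  left-right (c2 s) = refl
  left-right (c3 s) = refl
  left-right (c4 s) = trans (left-start (next s)) (cong c4 (prev-next s))

  left-injective : Injective _≡_ _≡_ left
  left-injective eq = trans (sym (right-left _)) (trans (cong right eq) (right-left _))

  right≢ : ∀ i → right i ≢ i
  right≢ (c4 s) eq with next s
  right≢ (c4 s) () | κ i
  right≢ (c4 s) () | ƛ j

  -- Every sector has at least three columns, so two steps cannot close up. Without this the edges
  -- between the `a`s could be double.
  right-right≢ : ∀ i → right (right i) ≢ i
  right-right≢ (c3 s) eq with next s
  right-right≢ (c3 s) () | κ i
  right-right≢ (c3 s) () | ƛ j
  right-right≢ (c4 s) eq with next s
  right-right≢ (c4 s) () | κ i
  right-right≢ (c4 s) () | ƛ j

  -- From one `c4` to that of the preceding sector it takes five or three steps to the left, so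
  -- transitivity passes from sectors to columns.
  reach-c4s₀ : ∀ i → Reach left i (c4 s₀)
  reach-c4s₀ = λ where
      (c0 i)     → fromC0 i
      (c1 i)     → reach-trans (1 , refl) (fromC0 i)
      (c2 (κ i)) → reach-trans (2 , refl) (fromC0 i)
      (c2 (ƛ j)) → reach-trans (1 , refl) (fromC4 _)
      (c3 s)     → reach-trans (1 , refl) (fromC2 s)
      (c4 s)     → fromC4 s
    where
    c4-prev : ∀ s → Reach left (c4 s) (c4 (prev s))
    c4-prev (κ i) = 5 , refl
    c4-prev (ƛ j) = 3 , refl

    fromC4′ : ∀ n {s} → fold s prev n ≡ s₀ → Reach left (c4 s) (c4 s₀)
    fromC4′ zero    refl = 0 , refl
    fromC4′ (suc n) eq   = reach-trans (c4-prev _) (fromC4′ n (trans (fold-suc _ n) eq))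

    fromC4 : ∀ s → Reach left (c4 s) (c4 s₀)
    fromC4 s = let n , eq = reach-s₀ s in fromC4′ n eq

    fromC0 : ∀ i → Reach left (c0 i) (c4 s₀)
    fromC0 i = reach-trans (1 , refl) (fromC4 (prev (κ i)))

    fromC2 : ∀ s → Reach left (c2 s) (c4 s₀)
    fromC2 (κ i) = reach-trans (2 , refl) (fromC0 i)
    fromC2 (ƛ j) = reach-trans (1 , refl) (fromC4 _)

  -- Numbers of vertices, darts and faces

  sectors columns : ℕ
  sectors = k ℕ.+ l
  columns = (2 ℕ.* k) ℕ.+ 3 ℕ.* sectors

  Sector↔ : Sector ↔ Fin sectors
  Sector↔ = ↔-id _ +↔ ↔-id _

  Face : Set
  Face = ⊤ ⊎ Column ⊎ Column ⊎ Sector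

  abstract

    Column↔ : Column ↔ Fin columns
    Column↔ = (↔-id (Fin 2) *↔ ↔-id (Fin k) +↔ ↔-id (Fin 3) *↔ Sector↔) ↔-∘ mk↔ₛ′
      (λ where (c0 i) → κ (0F , i)
               (c1 i) → κ (1F , i)
               (c2 s) → ƛ (0F , s)
               (c3 s) → ƛ (1F , s)
               (c4 s) → ƛ (2F , s))
      (λ where (κ (0F , i)) → c0 i
               (κ (1F , i)) → c1 i
               (ƛ (0F , s)) → c2 s
               (ƛ (1F , s)) → c3 s
               (ƛ (2F , s)) → c4 s)
      (λ where (κ (0F , i)) → refl
               (κ (1F , i)) → refl
               (ƛ (0F , s)) → refl
               (ƛ (1F , s)) → refl
               (ƛ (2F , s)) → refl)
      (λ where (c0 i) → refl
               (c1 i) → refl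
               (c2 s) → refl
               (c3 s) → refl
               (c4 s) → refl)

    V↔ : V ↔ Fin (3 ℕ.* columns ℕ.+ (k ℕ.+ (3 ℕ.* sectors ℕ.+ 1)))
    V↔ = (↔-id (Fin 3) *↔ Column↔ +↔ ↔-id (Fin k) +↔ ↔-id (Fin 3) *↔ Sector↔ +↔ ↔-sym Finₚ.1↔⊤) ↔-∘ mk↔ₛ′
      (λ where (a i)  → inj₁ (0F , i)
               (b i)  → inj₁ (1F , i)
               (c i)  → inj₁ (2F , i)
               (d1 i) → inj₂ (inj₁ i)
               (d2 s) → inj₂ (inj₂ (inj₁ (0F , s)))
               (d3 s) → inj₂ (inj₂ (inj₁ (1F , s)))
               (d4 s) → inj₂ (inj₂ (inj₁ (2F , s)))
               z      → inj₂ (inj₂ (inj₂ tt)))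
      (λ where (inj₁ (0F , i)) → a i
               (inj₁ (1F , i)) → b i
               (inj₁ (2F , i)) → c i
               (inj₂ (inj₁ i)) → d1 i
               (inj₂ (inj₂ (inj₁ (0F , s)))) → d2 s
               (inj₂ (inj₂ (inj₁ (1F , s)))) → d3 s
               (inj₂ (inj₂ (inj₁ (2F , s)))) → d4 s
               (inj₂ (inj₂ (inj₂ tt))) → z)
      (λ where (inj₁ (0F , i)) → refl
               (inj₁ (1F , i)) → refl
               (inj₁ (2F , i)) → refl
               (inj₂ (inj₁ i)) → refl
               (inj₂ (inj₂ (inj₁ (0F , s)))) → refl
               (inj₂ (inj₂ (inj₁ (1F , s)))) → refl
               (inj₂ (inj₂ (inj₁ (2F , s)))) → refl
               (inj₂ (inj₂ (inj₂ tt))) → refl)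
      (λ where (a i)  → refl
               (b i)  → refl
               (c i)  → refl
               (d1 i) → refl
               (d2 s) → refl
               (d3 s) → refl
               (d4 s) → refl
               z      → refl)

    D↔ : D ↔ Fin (columns ℕ.+ (columns ℕ.* 5 ℕ.+ (columns ℕ.* 5 ℕ.+ sectors ℕ.* 5)))
    D↔ = (Column↔ +↔ Column↔ *↔ ↔-id (Fin 5) +↔ Column↔ *↔ ↔-id (Fin 5) +↔ Sector↔ *↔ ↔-id (Fin 5)) ↔-∘ mk↔ₛ′
      (λ where (O i)   → inj₁ i
               (P i r) → inj₂ (inj₁ (i , r))
               (Q i r) → inj₂ (inj₂ (inj₁ (i , r)))
               (X s r) → inj₂ (inj₂ (inj₂ (s , r))))
      (λ where (inj₁ i)                      → O i
               (inj₂ (inj₁ (i , r)))         → P i r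
               (inj₂ (inj₂ (inj₁ (i , r))))  → Q i r
               (inj₂ (inj₂ (inj₂ (s , r))))  → X s r)
      (λ where (inj₁ i)                      → refl
               (inj₂ (inj₁ (i , r)))         → refl
               (inj₂ (inj₂ (inj₁ (i , r))))  → refl
               (inj₂ (inj₂ (inj₂ (s , r))))  → refl)
      (λ where (O i)   → refl
               (P i r) → refl
               (Q i r) → refl
               (X s r) → refl)

    Face↔ : Face ↔ Fin (suc (columns ℕ.+ (columns ℕ.+ sectors)))
    Face↔ = ↔-sym Finₚ.1↔⊤ +↔ Column↔ +↔ Column↔ +↔ Sector↔

  -- All special columns c0 share the central vertex z.
  inner : Column → V
  inner (c0 i) = z
  inner (c1 i) = d1 i
  inner (c2 s) = d2 s
  inner (c3 s) = d3 s
  inner (c4 s) = d4 s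

  -- The central pentagon of s has the vertices z, rim s, d2 s, d3 s, d4 s; a sector of the second
  -- kind is glued to the preceding one along the edge from z to d4.
  rim : Sector → V
  rim (κ i) = d1 i
  rim (ƛ j) = d4 (prev (ƛ j))

  tail : D → V
  tail (O i)    = a (right i)
  tail (P i 0F) = a i
  tail (P i 1F) = a (right i)
  tail (P i 2F) = b (right i)
  tail (P i 3F) = c i
  tail (P i 4F) = b i
  tail (Q i 0F) = c i
  tail (Q i 1F) = b (right i)
  tail (Q i 2F) = c (right i)
  tail (Q i 3F) = inner (right i)
  tail (Q i 4F) = inner i
  tail (X s 0F) = z
  tail (X s 1F) = rim s
  tail (X s 2F) = d2 s
  tail (X s 3F) = d3 s
  tail (X s 4F) = d4 s

  -- The central side of the step that the inner walk takes after `d4 s`. Before a sector of the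
  -- first kind this step returns to `z` along the pentagon of `s`; before one of the second kind it
  -- is already an edge of the next pentagon. The second argument is always `next s`, kept separate
  -- for the case distinction.
  afterLast : Sector → Sector → D
  afterLast s (κ i) = X s 4F
  afterLast s (ƛ j) = X (ƛ j) 1F

  -- The far side of the edge from `d4 s` to `z`: the inner ring if a sector of the first kind
  -- follows, otherwise the next central pentagon, which shares this edge.
  lastSpoke : Sector → Sector → D
  lastSpoke s (κ i) = Q (c4 s) 3F
  lastSpoke s (ƛ j) = X (ƛ j) 0F

  inwards : Column → D
  inwards (c0 i) = X (κ i) 0F
  inwards (c1 i) = X (κ i) 1F
  inwards (c2 s) = X s 2F
  inwards (c3 s) = X s 3F
  inwards (c4 s) = afterLast s (next s)

  firstSpoke beforeSecond : Sector → D
  firstSpoke (κ i)   = Q (c0 i) 3F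
  firstSpoke (ƛ j)   = X (prev (ƛ j)) 4F
  beforeSecond (κ i) = Q (c1 i) 3F
  beforeSecond (ƛ j) = Q (c4 (prev (ƛ j))) 3F

  rev : D → D
  rev (O i) = P i 0F
  rev (P i 0F) = O i
  rev (P i 1F) = P (right i) 4F
  rev (P i 2F) = Q i 0F
  rev (P i 3F) = Q (left i) 1F
  rev (P i 4F) = P (left i) 1F
  rev (Q i 0F) = P i 2F
  rev (Q i 1F) = P (right i) 3F
  rev (Q i 2F) = Q (right i) 4F
  rev (Q i 3F) = inwards i
  rev (Q i 4F) = Q (left i) 2F
  rev (X s 0F) = firstSpoke s
  rev (X s 1F) = beforeSecond s
  rev (X s 2F) = Q (c2 s) 3F
  rev (X s 3F) = Q (c3 s) 3F
  rev (X s 4F) = lastSpoke s (next s)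

  rev-rev : ∀ d → rev (rev d) ≡ d
  rev-rev (O i)         = refl
  rev-rev (P i 0F)      = refl
  rev-rev (P i 1F)      = cong (λ i → P i 1F) (left-right i)
  rev-rev (P i 2F)      = refl
  rev-rev (P i 3F)      = cong (λ i → P i 3F) (right-left i)
  rev-rev (P i 4F)      = cong (λ i → P i 4F) (right-left i)
  rev-rev (Q i 0F)      = refl
  rev-rev (Q i 1F)      = cong (λ i → Q i 1F) (left-right i)
  rev-rev (Q i 2F)      = cong (λ i → Q i 2F) (left-right i)
  rev-rev (Q (c0 i) 3F) = refl
  rev-rev (Q (c1 i) 3F) = refl
  rev-rev (Q (c2 s) 3F) = refl
  rev-rev (Q (c3 s) 3F) = refl
  rev-rev (Q (c4 s) 3F) with next s in eq
  ... | κ i = cong (lastSpoke s) eq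
  ... | ƛ j = cong (λ s → Q (c4 s) 3F) (trans (cong prev (sym eq)) (prev-next s))
  rev-rev (Q i 4F)      = cong (λ i → Q i 4F) (right-left i)
  rev-rev (X (κ i) 0F)  = refl
  rev-rev (X (ƛ j) 0F)  = cong (lastSpoke _) (next-prev (ƛ j))
  rev-rev (X (κ i) 1F)  = refl
  rev-rev (X (ƛ j) 1F)  = cong (afterLast _) (next-prev (ƛ j))
  rev-rev (X s 2F)      = refl
  rev-rev (X s 3F)      = refl
  rev-rev (X s 4F) with next s in eq
  ... | κ i = cong (afterLast s) eq
  ... | ƛ j = cong (λ s → X s 4F) (trans (cong prev (sym eq)) (prev-next s))

  spin spin⁻¹ : Fin 5 → Fin 5
  spin 0F = 1F
  spin 1F = 2F
  spin 2F = 3F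
  spin 3F = 4F
  spin 4F = 0F
  spin⁻¹ 0F = 4F
  spin⁻¹ 1F = 0F
  spin⁻¹ 2F = 1F
  spin⁻¹ 3F = 2F
  spin⁻¹ 4F = 3F

  spin⁻¹-spin : ∀ r → spin⁻¹ (spin r) ≡ r
  spin⁻¹-spin 0F = refl
  spin⁻¹-spin 1F = refl
  spin⁻¹-spin 2F = refl
  spin⁻¹-spin 3F = refl
  spin⁻¹-spin 4F = refl

  φ φ⁻¹ : D → D
  -- The outer face lies on the other side of the edges between the `a`s and runs through them
  -- against the order of the columns.
  φ (O i)   = O (left i)
  φ (P i r) = P i (spin r)
  φ (Q i r) = Q i (spin r)
  φ (X s r) = X s (spin r)
  φ⁻¹ (O i)   = O (right i)
  φ⁻¹ (P i r) = P i (spin⁻¹ r)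
  φ⁻¹ (Q i r) = Q i (spin⁻¹ r)
  φ⁻¹ (X s r) = X s (spin⁻¹ r)

  φ⁻¹-φ : ∀ d → φ⁻¹ (φ d) ≡ d
  φ⁻¹-φ (O i)   = cong O (right-left i)
  φ⁻¹-φ (P i r) = cong (P i) (spin⁻¹-spin r)
  φ⁻¹-φ (Q i r) = cong (Q i) (spin⁻¹-spin r)
  φ⁻¹-φ (X s r) = cong (X s) (spin⁻¹-spin r)

  head : D → V
  head d = tail (rev d)

  turn : D → D
  turn d = φ (rev d)

  tail-turn : ∀ d → tail (turn d) ≡ tail d
  tail-turn (O i)         = refl
  tail-turn (P i 0F)      = cong a (right-left i)
  tail-turn (P i 1F)      = refl
  tail-turn (P i 2F)      = refl
  tail-turn (P i 3F)      = cong c (right-left i)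
  tail-turn (P i 4F)      = cong b (right-left i)
  tail-turn (Q i 0F)      = refl
  tail-turn (Q i 1F)      = refl
  tail-turn (Q i 2F)      = refl
  tail-turn (Q (c0 i) 3F) = refl
  tail-turn (Q (c1 i) 3F) = refl
  tail-turn (Q (c2 s) 3F) = refl
  tail-turn (Q (c3 s) 3F) = refl
  tail-turn (Q (c4 s) 3F) with next s
  ... | κ i = refl
  ... | ƛ j = refl
  tail-turn (Q i 4F)      = cong inner (right-left i)
  tail-turn (X (κ i) 0F)  = refl
  tail-turn (X (ƛ j) 0F)  = refl
  tail-turn (X (κ i) 1F)  = refl
  tail-turn (X (ƛ j) 1F)  = refl
  tail-turn (X s 2F)      = refl
  tail-turn (X s 3F)      = refl
  tail-turn (X s 4F) with next s in eq
  ... | κ i = refl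
  ... | ƛ j = cong d4 (trans (cong prev (sym eq)) (prev-next s))

  -- Absence of loops and multiple edges

  a-injective : ∀ {i j} → a i ≡ a j → i ≡ j
  a-injective refl = refl

  b-injective : ∀ {i j} → b i ≡ b j → i ≡ j
  b-injective refl = refl

  c-injective : ∀ {i j} → c i ≡ c j → i ≡ j
  c-injective refl = refl

  inner-right≢ : ∀ i → inner (right i) ≢ inner i
  inner-right≢ (c4 s) eq with next s
  inner-right≢ (c4 s) () | κ i
  inner-right≢ (c4 s) () | ƛ j

  head-inwards : ∀ i → tail (inwards i) ≡ inner i
  head-inwards (c0 i) = refl
  head-inwards (c1 i) = refl
  head-inwards (c2 s) = refl
  head-inwards (c3 s) = refl
  head-inwards (c4 s) with next s in eq
  ... | κ i = refl
  ... | ƛ j = cong d4 (trans (cong prev (sym eq)) (prev-next s))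

  head-X4 : ∀ s → head (X s 4F) ≡ z
  head-X4 s with next s in eq
  ... | κ i = cong (inner ∘ start) eq
  ... | ƛ j = refl

  head-X1 : ∀ s → head (X s 1F) ≡ d2 s
  head-X1 (κ i) = refl
  head-X1 (ƛ j) = cong (inner ∘ start) (next-prev (ƛ j))

  loopless : ∀ d → head d ≢ tail d
  loopless (O i)        eq = right≢ i (sym (a-injective eq))
  loopless (P i 0F)     eq = right≢ i (a-injective eq)
  loopless (Q i 3F)     eq = inner-right≢ i (trans (sym eq) (head-inwards i))
  loopless (X (κ i) 0F) ()
  loopless (X (ƛ j) 0F) ()
  loopless (X (κ i) 1F) ()
  loopless (X (ƛ j) 1F) eq with trans (sym (head-X1 (ƛ j))) eq
  ... | ()
  loopless (X s 4F)     eq with trans (sym (head-X4 s)) eq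
  ... | ()
  loopless (P i 1F) ()
  loopless (P i 2F) ()
  loopless (P i 3F) ()
  loopless (P i 4F) ()
  loopless (Q i 2F) eq = inner≢c (right i) eq
    where
    inner≢c : ∀ i {j} → inner i ≢ c j
    inner≢c (c0 i) ()
    inner≢c (c1 i) ()
    inner≢c (c2 i) ()
    inner≢c (c3 i) ()
    inner≢c (c4 i) ()
  loopless (Q (c0 i) 4F) ()
  loopless (Q (c1 i) 4F) ()
  loopless (Q (c2 i) 4F) ()
  loopless (Q (c3 i) 4F) ()
  loopless (Q (c4 i) 4F) ()

  _≟ᶜ_ : DecidableEquality Column
  _≟ᶜ_ = Finₚ.inj⇒≟ (↔⇒↣ Column↔)

  -- Arbitrary when the two vertices are not adjacent.
  between : V → V → D
  between (a i) (a j) with j ≟ᶜ right i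
  ... | yes _ = P i 0F
  ... | no _  = O j
  between (a i) (b j) = P (left j) 1F
  between (b i) (a j) = P j 4F
  between (b i) (c j) with j ≟ᶜ i
  ... | yes _ = Q (left j) 1F
  ... | no _  = P j 2F
  between (c i) (b j) with j ≟ᶜ i
  ... | yes _ = P j 3F
  ... | no _  = Q i 0F
  between (c i) _      = Q (left i) 2F
  between z (c j)      = Q j 4F
  between z (d1 i)     = X (κ i) 0F
  between z (d4 s)     = lastSpoke s (next s)
  between (d1 i) (c j) = Q j 4F
  between (d1 i) z     = Q (c0 i) 3F
  between (d1 i) _     = X (κ i) 1F
  between (d2 s) (c j) = Q j 4F
  between (d2 s) (d3 t) = X s 2F
  between (d2 (κ i)) _ = Q (c1 i) 3F
  between (d2 (ƛ j)) _ = Q (c4 (prev (ƛ j))) 3F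
  between (d3 s) (c j)  = Q j 4F
  between (d3 s) (d2 t) = Q (c2 s) 3F
  between (d3 s) _      = X s 3F
  between (d4 s) (c j)  = Q j 4F
  between (d4 s) (d3 t) = Q (c3 s) 3F
  between (d4 s) z      = X s 4F
  between (d4 s) (d2 t) = X t 1F
  between _ _           = O (c4 s₀)

  -- Recovering a dart from its ends proves simplicity with one case for each kind of dart rather
  -- than for each pair of kinds.
  between-spec : ∀ d → between (tail d) (head d) ≡ d
  between-spec (O i) with i ≟ᶜ right (right i)
  ... | yes eq = contradiction (sym eq) (right-right≢ i)
  ... | no _   = refl
  between-spec (P i 0F) with right i ≟ᶜ right i
  ... | yes _  = refl
  ... | no neq = contradiction refl neq
  between-spec (P i 1F) = cong (λ i → P i 1F) (left-right i)
  between-spec (P i 2F) with i ≟ᶜ right i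
  ... | yes eq = contradiction (sym eq) (right≢ i)
  ... | no _   = refl
  between-spec (P i 3F) rewrite right-left i with i ≟ᶜ i
  ... | yes _  = refl
  ... | no neq = contradiction refl neq
  between-spec (P i 4F) rewrite right-left i = refl
  between-spec (Q i 0F) with right i ≟ᶜ i
  ... | yes eq = contradiction eq (right≢ i)
  ... | no _   = refl
  between-spec (Q i 1F) with right i ≟ᶜ right i
  ... | yes _  = cong (λ i → Q i 1F) (left-right i)
  ... | no neq = contradiction refl neq
  between-spec (Q i 2F) = trans (toInner (right i)) (cong (λ i → Q i 2F) (left-right i))
    where
    toInner : ∀ {i} j → between (c i) (inner j) ≡ Q (left i) 2F
    toInner (c0 i) = refl
    toInner (c1 i) = refl
    toInner (c2 s) = refl
    toInner (c3 s) = refl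
    toInner (c4 s) = refl
  between-spec (Q i 3F) rewrite head-inwards i = outwards i
    where
    outwards : ∀ i → between (inner (right i)) (inner i) ≡ Q i 3F
    outwards (c0 i) = refl
    outwards (c1 i) = refl
    outwards (c2 s) = refl
    outwards (c3 s) = refl
    outwards (c4 s) with next s in eq
    ... | κ i = cong (lastSpoke s) eq
    ... | ƛ j = cong (λ s → Q (c4 s) 3F) (trans (cong prev (sym eq)) (prev-next s))
  between-spec (Q i 4F) rewrite right-left i = fromInner i
    where
    fromInner : ∀ i → between (inner i) (c i) ≡ Q i 4F
    fromInner (c0 i) = refl
    fromInner (c1 i) = refl
    fromInner (c2 s) = refl
    fromInner (c3 s) = refl
    fromInner (c4 s) = refl
  between-spec (X (κ i) 0F) = refl
  between-spec (X (ƛ j) 0F) = cong (lastSpoke _) (next-prev (ƛ j))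
  between-spec (X s 1F) rewrite head-X1 s = fromRim s
    where
    fromRim : ∀ s → between (rim s) (d2 s) ≡ X s 1F
    fromRim (κ i) = refl
    fromRim (ƛ j) = refl
  between-spec (X s 2F) = refl
  between-spec (X s 3F) = refl
  between-spec (X s 4F) rewrite head-X4 s = refl

  simple : ∀ {d e} → tail d ≡ tail e → head d ≡ head e → d ≡ e
  simple {d} {e} t h = trans (sym (between-spec d)) (trans (cong₂ between t h) (between-spec e))

  -- The rotation at each vertex

  anchor : V → D
  anchor (a i)  = P i 0F
  anchor (b i)  = P i 4F
  anchor (c i)  = P i 3F
  anchor (d1 i) = Q (c1 i) 4F
  anchor (d2 s) = Q (c2 s) 4F
  anchor (d3 s) = Q (c3 s) 4F
  anchor (d4 s) = Q (c4 s) 4F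
  anchor z      = X s₀ 0F

  module _ where
    private
      -- One turn, unless a sector of the second kind follows: then its pentagon also has a corner
      -- at `d4 s`, which costs a second turn.
      reach-X4 : ∀ s → Reach turn (X s 4F) (Q (c4 s) 4F)
      reach-X4 s with next s in eq
      ... | κ i = 1 , cong (φ ∘ lastSpoke s) eq
      ... | ƛ j = 2 , trans (cong (turn ∘ φ ∘ lastSpoke s) eq)
                            (cong (λ s → Q (c4 s) 4F) (trans (cong prev (sym eq)) (prev-next s)))

      reach-c4-3 : ∀ i → Reach turn (Q (c4 (prev (κ i))) 3F) (X (prev (κ i)) 0F)
      reach-c4-3 i = 1 , cong (φ ∘ afterLast (prev (κ i))) (next-prev (κ i))

      -- Around `z`, two pentagons of the inner ring separate a sector of the first kind from its
      -- predecessor, which makes three turns; a sector of the second kind shares a spoke with its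
      -- predecessor, which makes one.
      reach-prev : ∀ s → Reach turn (X s 0F) (X (prev s) 0F)
      reach-prev (κ i) = reach-trans (2 , refl) (reach-c4-3 i)
      reach-prev (ƛ j) = 1 , refl

      reach-Xs₀′ : ∀ n {s} → fold s prev n ≡ s₀ → Reach turn (X s 0F) (X s₀ 0F)
      reach-Xs₀′ zero    refl = 0 , refl
      reach-Xs₀′ (suc n) eq   = reach-trans (reach-prev _) (reach-Xs₀′ n (trans (fold-suc _ n) eq))

      reach-Xs₀ : ∀ s → Reach turn (X s 0F) (X s₀ 0F)
      reach-Xs₀ s = let n , eq = reach-s₀ s in reach-Xs₀′ n eq

    reach-anchor : ∀ d → Reach turn d (anchor (tail d))
    reach-anchor (O i)         = 2 , refl
    reach-anchor (P i 0F)      = 0 , refl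
    reach-anchor (P i 1F)      = 1 , refl
    reach-anchor (P i 2F)      = 2 , refl
    reach-anchor (P i 3F)      = 0 , refl
    reach-anchor (P i 4F)      = 0 , refl
    reach-anchor (Q i 0F)      = 1 , refl
    reach-anchor (Q i 1F)      = 1 , refl
    reach-anchor (Q i 2F)      = 2 , refl
    reach-anchor (Q (c0 i) 3F) = 2 , refl
    reach-anchor (Q (c1 i) 3F) = 2 , refl
    reach-anchor (Q (c2 s) 3F) = 2 , refl
    reach-anchor (Q (c3 s) 3F) = reach-trans (1 , refl) (reach-X4 s)
    reach-anchor (Q (c4 s) 3F) with next s in eq
    ... | κ i = reach-trans (1 , cong (φ ∘ afterLast s) eq) (reach-Xs₀ s)
    ... | ƛ j = 2 , cong (turn ∘ φ ∘ afterLast s) eq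
    reach-anchor (Q (c0 i) 4F) = reach-trans (1 , refl) (reach-trans (reach-c4-3 i) (reach-Xs₀ _))
    reach-anchor (Q (c1 i) 4F) = 0 , refl
    reach-anchor (Q (c2 s) 4F) = 0 , refl
    reach-anchor (Q (c3 s) 4F) = 0 , refl
    reach-anchor (Q (c4 s) 4F) = 0 , refl
    reach-anchor (X s 0F)      = reach-Xs₀ s
    reach-anchor (X (κ i) 1F)  = 1 , refl
    reach-anchor (X (ƛ j) 1F)  = 1 , refl
    reach-anchor (X s 2F)      = 1 , refl
    reach-anchor (X s 3F)      = 1 , refl
    reach-anchor (X s 4F)      = reach-X4 s

  -- Faces and Euler's formula

  open Inverse Face↔ using ()
    renaming (to to faceIndex; from to faceIndex⁻¹
             ; strictlyInverseˡ to faceIndex-faceIndex⁻¹; strictlyInverseʳ to faceIndex⁻¹-faceIndex)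

  face : D → Face
  face (O i)   = inj₁ tt
  face (P i r) = inj₂ (inj₁ i)
  face (Q i r) = inj₂ (inj₂ (inj₁ i))
  face (X s r) = inj₂ (inj₂ (inj₂ s))

  base : Face → D
  base (inj₁ tt)               = O (c4 s₀)
  base (inj₂ (inj₁ i))         = P i 0F
  base (inj₂ (inj₂ (inj₁ i)))  = Q i 0F
  base (inj₂ (inj₂ (inj₂ s)))  = X s 0F

  face-base : ∀ f → face (base f) ≡ f
  face-base (inj₁ tt)               = refl
  face-base (inj₂ (inj₁ i))         = refl
  face-base (inj₂ (inj₂ (inj₁ i)))  = refl
  face-base (inj₂ (inj₂ (inj₂ s)))  = refl

  face-φ : ∀ d → face (φ d) ≡ face d
  face-φ (O i)   = refl
  face-φ (P i r) = refl
  face-φ (Q i r) = refl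
  face-φ (X s r) = refl

  fold-O : ∀ i n → fold (O i) φ n ≡ O (fold i left n)
  fold-O i zero    = refl
  fold-O i (suc n) = cong φ (fold-O i n)

  module Left = FiniteDynamics Column↔ left left-injective

  left-transitive : ∀ i j → Reach left i j
  left-transitive i j = reach-trans (reach-c4s₀ i) (Left.reach-sym (reach-c4s₀ j))

  reach-spin : (F : Fin 5 → D) → (∀ r → φ (F r) ≡ F (spin r)) → ∀ r → Reach φ (F 0F) (F r)
  reach-spin F eq = λ where
      0F → 0 , refl
      1F → step 0F (0 , refl)
      2F → step 1F (step 0F (0 , refl))
      3F → step 2F (step 1F (step 0F (0 , refl)))
      4F → step 3F (step 2F (step 1F (step 0F (0 , refl))))
    where
    step : ∀ r → Reach φ (F 0F) (F r) → Reach φ (F 0F) (F (spin r))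
    step r reach = reach-trans reach (1 , eq r)

  reach-base : ∀ d → Reach φ (base (face d)) d
  reach-base (O i)   = let n , eq = left-transitive (c4 s₀) i in n , trans (fold-O _ n) (cong O eq)
  reach-base (P i r) = reach-spin (P i) (λ _ → refl) r
  reach-base (Q i r) = reach-spin (Q i) (λ _ → refl) r
  reach-base (X s r) = reach-spin (X s) (λ _ → refl) r

  euler : 2 ℕ.* (3 ℕ.* columns ℕ.+ (k ℕ.+ (3 ℕ.* sectors ℕ.+ 1))) ℕ.+ 2 ℕ.* suc (columns ℕ.+ (columns ℕ.+ sectors))
    ≡ (columns ℕ.+ (columns ℕ.* 5 ℕ.+ (columns ℕ.* 5 ℕ.+ sectors ℕ.* 5))) ℕ.+ 4
  euler = identity k sectors
    where
    identity : ∀ k m → let n = 2 ℕ.* k ℕ.+ 3 ℕ.* m in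
      2 ℕ.* (3 ℕ.* n ℕ.+ (k ℕ.+ (3 ℕ.* m ℕ.+ 1))) ℕ.+ 2 ℕ.* suc (n ℕ.+ (n ℕ.+ m))
      ≡ (n ℕ.+ (n ℕ.* 5 ℕ.+ (n ℕ.* 5 ℕ.+ m ℕ.* 5))) ℕ.+ 4
    identity = solve-∀

  dartMap : DartMap _ _ _
  dartMap = record
    { V = V ; D = D ; V↔ = V↔ ; D↔ = D↔ ; tail = tail ; rev = rev ; φ = φ ; φ⁻¹ = φ⁻¹
    ; rev-rev = rev-rev ; φ⁻¹-φ = φ⁻¹-φ ; tail-turn = tail-turn ; loopless = loopless ; simple = simple
    ; anchor = anchor ; reach-anchor = reach-anchor
    ; face = faceIndex ∘ face ; face-φ = cong faceIndex ∘ face-φ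
    ; base = base ∘ faceIndex⁻¹
    ; face-base = λ i → trans (cong faceIndex (face-base (faceIndex⁻¹ i))) (faceIndex-faceIndex⁻¹ i)
    ; reach-base = λ d → subst (λ f → Reach φ (base f) d) (sym (faceIndex⁻¹-faceIndex (face d))) (reach-base d)
    ; euler = euler
    }

  -- Three-connectedness: two vertices miss one of the three disjoint cycles formed by the a's,
  -- by the b's and c's, and by the inner vertices, and every other vertex can still reach it.

  row : V → Fin 4
  row (a i) = 0F
  row (b i) = 1F
  row (c i) = 2F
  row _     = 3F

  row-inner : ∀ i → row (inner i) ≡ 3F
  row-inner (c0 i) = refl
  row-inner (c1 i) = refl
  row-inner (c2 s) = refl
  row-inner (c3 s) = refl
  row-inner (c4 s) = refl

  left≢ : ∀ i → left i ≢ i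
  left≢ i eq = right≢ (left i) (trans (right-left i) (sym eq))

  left≢right : ∀ i → left i ≢ right i
  left≢right i eq = right-right≢ i (trans (cong right (sym eq)) (right-left i))

  -- As the inner walk may revisit `z`, distinct columns do not settle this. It keeps the detours to
  -- the left and to the right of an inner vertex disjoint.
  inner-left≢right : ∀ i → inner (left i) ≢ inner (right i)
  inner-left≢right (c2 (κ i)) ()
  inner-left≢right (c2 (ƛ j)) ()
  inner-left≢right (c4 s) eq with next s
  inner-left≢right (c4 s) () | κ i
  inner-left≢right (c4 s) () | ƛ j

  open DartMap dartMap using (Edge; Robust)

  edge-sym : ∀ {u v} → Edge u v → Edge v u
  edge-sym (d , t , h) = rev d , h , trans (cong tail (rev-rev d)) t

  aa : ∀ i → Edge (a i) (a (right i))
  aa i = P i 0F , refl , refl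

  ba : ∀ i → Edge (b i) (a i)
  ba i = P i 4F , refl , cong a (right-left i)

  cb : ∀ i → Edge (c i) (b i)
  cb i = P i 3F , refl , cong b (right-left i)

  cb-right : ∀ i → Edge (c i) (b (right i))
  cb-right i = Q i 0F , refl , refl

  inner-c : ∀ i → Edge (inner i) (c i)
  inner-c i = Q i 4F , refl , cong c (right-left i)

  inner-inner : ∀ i → Edge (inner (right i)) (inner i)
  inner-inner i = Q i 3F , refl , head-inwards i

  any-column? : {R : Column → Set} → (∀ i → Dec (R i)) → Dec (∃ R)
  any-column? {R} R? = map′ (λ (i , r) → from i , r)
      (λ (i , r) → to i , subst R (sym (strictlyInverseʳ i)) r) (Finₚ.any? (λ i → R? (from i)))
    where open Inverse Column↔

  module Deletion (Bad : V → Set) (bad? : ∀ v → Dec (Bad v))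
    (few : ∀ {u v w} → u ≢ v → w ≢ u → w ≢ v → Bad u → Bad v → ¬ Bad w) where

    infix 4 _⟶_
    _⟶_ : V → V → Set
    _⟶_ = Star (λ u v → ¬ Bad u × ¬ Bad v × Edge u v)

    ⟶-sym : ∀ {u v} → u ⟶ v → v ⟶ u
    ⟶-sym = Star.reverse λ (gu , gv , uv) → gv , gu , edge-sym uv

    along : ∀ {u v w} → ¬ Bad u → ¬ Bad v → Edge u v → v ⟶ w → u ⟶ w
    along gu gv uv vw = (gu , gv , uv) ◅ vw

    against : ∀ {u v w} → ¬ Bad u → ¬ Bad v → Edge v u → v ⟶ w → u ⟶ w
    against gu gv vu = along gu gv (edge-sym vu)

    -- `inner i` does not reduce for a variable column, so no absurd pattern tells it from an `a`,
    -- `b` or `c`; the `row` does.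
    inner-apart : ∀ {u} i → row u ≢ 3F → inner i ≢ u
    inner-apart i neq refl = neq (row-inner i)

    cycle : (F : Column → V) → (∀ i → F (right i) ⟶ F i) → ∀ i j → F i ⟶ F j
    cycle F step i j with left-transitive i j
    ... | n , refl = go n
      where
      go : ∀ n → F i ⟶ F (fold i left n)
      go zero    = ε
      go (suc n) = go n ◅◅ subst (λ x → F x ⟶ F (left (fold i left n))) (right-left _) (step (left (fold i left n)))

    Linked : Set
    Linked = ∀ {u v} → ¬ Bad u → ¬ Bad v → u ⟶ v

    towards : ∀ {hub} → (∀ i → ¬ Bad (a i) → a i ⟶ hub) → (∀ i → ¬ Bad (b i) → b i ⟶ hub) →
      (∀ i → ¬ Bad (c i) → c i ⟶ hub) → (∀ i → ¬ Bad (inner i) → inner i ⟶ hub) →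
      Linked
    towards {hub} from-a from-b from-c from-inner gu gv = toHub _ gu ◅◅ ⟶-sym (toHub _ gv)
      where
      toHub : ∀ v → ¬ Bad v → v ⟶ hub
      toHub (a i)  = from-a i
      toHub (b i)  = from-b i
      toHub (c i)  = from-c i
      toHub (d1 i) = from-inner (c1 i)
      toHub (d2 s) = from-inner (c2 s)
      toHub (d3 s) = from-inner (c3 s)
      toHub (d4 s) = from-inner (c4 s)
      -- `z` counts as an inner vertex through any column `c0`, and `i₀` provides one.
      toHub z      = from-inner (c0 i₀)

    module ViaA (good-a : ∀ i → ¬ Bad (a i)) where

      from-a : ∀ i → a i ⟶ a (c4 s₀)
      from-a i = cycle a (λ i → against (good-a _) (good-a _) (aa i) ε) i (c4 s₀)

      from-b : ∀ i → ¬ Bad (b i) → b i ⟶ a (c4 s₀)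
      from-b i gb = along gb (good-a i) (ba i) (from-a i)

      from-c : ∀ i → ¬ Bad (c i) → c i ⟶ a (c4 s₀)
      from-c i gc with bad? (b i) | bad? (b (right i))
      ... | no gb  | _      = along gc gb (cb i) (from-b i gb)
      ... | yes _  | no gb  = along gc gb (cb-right i) (from-b _ gb)
      -- Both deletions are spent on these `b`s, so the way inwards, one column to the right and out
      -- again at `b (right (right i))` is free.
      ... | yes bb | yes bb′ =
        against gc (good-inner i) (inner-c i) $
        against (good-inner i) (good-inner (right i)) (inner-inner i) $
        along (good-inner (right i)) good-c (inner-c (right i)) $
        along good-c good-b (cb-right (right i)) $
        from-b _ good-b
        where
        others : ∀ {v} → v ≢ b i → v ≢ b (right i) → ¬ Bad v
        others v≢ v≢′ = few (λ eq → right≢ i (sym (b-injective eq))) v≢ v≢′ bb bb′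

        good-inner : ∀ j → ¬ Bad (inner j)
        good-inner j = others (inner-apart j λ ()) (inner-apart j λ ())

        good-c : ¬ Bad (c (right i))
        good-c = others (λ ()) (λ ())

        good-b : ¬ Bad (b (right (right i)))
        good-b = others (right-right≢ i ∘ b-injective) (right≢ (right i) ∘ b-injective)

      from-inner : ∀ i → ¬ Bad (inner i) → inner i ⟶ a (c4 s₀)
      from-inner i gi with bad? (c i)
      ... | no gc  = along gi gc (inner-c i) (from-c i gc)
      -- Besides `c i` at most one vertex is bad, and it cannot block both the route over column
      -- `right i` and the disjoint one over `left i`.
      ... | yes bc = detour (bad? (inner (right i))) (bad? (c (right i)))
        where
        leftwards : ¬ Bad (inner (left i)) → ¬ Bad (c (left i)) → inner i ⟶ a (c4 s₀)
        leftwards gi′ gc = along gi gi′ (subst (λ j → Edge (inner j) (inner (left i))) (right-left i) (inner-inner (left i))) $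
          along gi′ gc (inner-c (left i)) $
          from-c (left i) gc

        detour : Dec (Bad (inner (right i))) → Dec (Bad (c (right i))) → inner i ⟶ a (c4 s₀)
        detour (no gi′) (no gc) =
          against gi gi′ (inner-inner i) $ along gi′ gc (inner-c (right i)) $ from-c (right i) gc
        detour (yes bi) _ = leftwards
          (few (inner-apart (right i) λ ()) (inner-left≢right i) (inner-apart (left i) λ ()) bi bc)
          (few (inner-apart (right i) λ ()) (≢-sym (inner-apart (right i) λ ())) (left≢ i ∘ c-injective) bi bc)
        detour (no _) (yes bc′) = leftwards
          (few (right≢ i ∘ c-injective) (inner-apart (left i) λ ()) (inner-apart (left i) λ ()) bc′ bc)
          (few (right≢ i ∘ c-injective) (left≢right i ∘ c-injective) (left≢ i ∘ c-injective) bc′ bc)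

      viaA : Linked
      viaA = towards (λ i _ → from-a i) from-b from-c from-inner

    module ViaBC (good-b : ∀ i → ¬ Bad (b i)) (good-c : ∀ i → ¬ Bad (c i)) where

      from-b : ∀ i → b i ⟶ b (c4 s₀)
      from-b i = cycle b (λ i → against (good-b _) (good-c i) (cb-right i) (along (good-c i) (good-b i) (cb i) ε)) i (c4 s₀)

      from-a : ∀ i → ¬ Bad (a i) → a i ⟶ b (c4 s₀)
      from-a i ga = against ga (good-b i) (ba i) (from-b i)

      from-c : ∀ i → c i ⟶ b (c4 s₀)
      from-c i = along (good-c i) (good-b i) (cb i) (from-b i)

      from-inner : ∀ i → ¬ Bad (inner i) → inner i ⟶ b (c4 s₀)
      from-inner i gi = along gi (good-c i) (inner-c i) (from-c i)

      viaBC : Linked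
      viaBC = towards from-a (λ i _ → from-b i) (λ i _ → from-c i) from-inner

    module ViaInner (good-inner : ∀ i → ¬ Bad (inner i)) where

      from-inner : ∀ i → inner i ⟶ inner (c4 s₀)
      from-inner i = cycle inner (λ i → along (good-inner _) (good-inner _) (inner-inner i) ε) i (c4 s₀)

      from-c : ∀ i → ¬ Bad (c i) → c i ⟶ inner (c4 s₀)
      from-c i gc = against gc (good-inner i) (inner-c i) (from-inner i)

      from-b : ∀ i → ¬ Bad (b i) → b i ⟶ inner (c4 s₀)
      from-b i gb with bad? (c i) | bad? (c (left i))
      ... | no gc  | _      = against gb gc (cb i) (from-c i gc)
      ... | yes _  | no gc  = against gb gc (subst (λ j → Edge (c (left i)) (b j)) (right-left i) (cb-right (left i))) (from-c _ gc)
      -- The mirror image of the detour in `ViaA`: outwards, one step along the `n`-gon and back in.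
      ... | yes bc | yes bc′ =
        along gb (good-a i) (ba i) $
        along (good-a i) (good-a (right i)) (aa i) $
        against (good-a (right i)) good-b (ba (right i)) $
        against good-b good-c (cb (right i)) $
        from-c _ good-c
        where
        others : ∀ {v} → v ≢ c i → v ≢ c (left i) → ¬ Bad v
        others v≢ v≢′ = few (λ eq → left≢ i (sym (c-injective eq))) v≢ v≢′ bc bc′

        good-a : ∀ j → ¬ Bad (a j)
        good-a j = others (λ ()) (λ ())

        good-b : ¬ Bad (b (right i))
        good-b = others (λ ()) (λ ())

        good-c : ¬ Bad (c (right i))
        good-c = others (right≢ i ∘ c-injective) (λ eq → left≢right i (sym (c-injective eq)))

      from-a : ∀ i → ¬ Bad (a i) → a i ⟶ inner (c4 s₀)
      from-a i ga with bad? (b i)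
      ... | no gb  = against ga gb (ba i) (from-b i gb)
      -- Again the one remaining bad vertex blocks the route on one side only.
      ... | yes bb = detour (bad? (a (right i))) (bad? (b (right i)))
        where
        leftwards : ¬ Bad (a (left i)) → ¬ Bad (b (left i)) → a i ⟶ inner (c4 s₀)
        leftwards ga′ gb = against ga ga′ (subst (λ j → Edge (a (left i)) (a j)) (right-left i) (aa (left i))) $
          against ga′ gb (ba (left i)) $
          from-b (left i) gb

        detour : Dec (Bad (a (right i))) → Dec (Bad (b (right i))) → a i ⟶ inner (c4 s₀)
        detour (no ga′) (no gb) = along ga ga′ (aa i) $ against ga′ gb (ba (right i)) $ from-b (right i) gb
        detour (yes ba) _ = leftwards
          (few (λ ()) (left≢right i ∘ a-injective) (λ ()) ba bb)
          (few (λ ()) (λ ()) (left≢ i ∘ b-injective) ba bb)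
        detour (no _) (yes bb′) = leftwards
          (few (right≢ i ∘ b-injective) (λ ()) (λ ()) bb′ bb)
          (few (right≢ i ∘ b-injective) (left≢right i ∘ b-injective) (left≢ i ∘ b-injective) bb′ bb)

      viaInner : Linked
      viaInner = towards from-a from-b from-c (λ i _ → from-inner i)

    open ViaA using (viaA)
    open ViaBC using (viaBC)
    open ViaInner using (viaInner)

    undisconnected : Linked
    undisconnected with any-column? (bad? ∘ a) | any-column? (bad? ∘ b) | any-column? (bad? ∘ c)
    ... | no none | _ | _ = viaA (λ i bad → none (i , bad))
    ... | yes _ | no none | no none′ = viaBC (λ i bad → none (i , bad)) (λ i bad → none′ (i , bad))
    -- A bad `a` together with a bad `b` or `c` exhausts the deletions, so all inner vertices
    -- survive.
    ... | yes (_ , ba) | yes (_ , bb) | _ =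
      viaInner λ i → few (λ ()) (inner-apart i λ ()) (inner-apart i λ ()) ba bb
    ... | yes (_ , ba) | no _ | yes (_ , bc) =
      viaInner λ i → few (λ ()) (inner-apart i λ ()) (inner-apart i λ ()) ba bc

  robust : Robust
  robust = Deletion.undisconnected

  -- Face lengths and the outer cycle

  3≤columns : 3 ℕ.≤ columns
  3≤columns = ℕₚ.≤-trans
    (ℕₚ.*-monoʳ-≤ 3 (ℕₚ.≤-trans (s≤s z≤n) (Finₚ.toℕ<n (Inverse.to Sector↔ s₀))))
    (ℕₚ.m≤n+m _ (2 ℕ.* k))

  3<order : 3 ℕ.< 3 ℕ.* columns ℕ.+ (k ℕ.+ (3 ℕ.* sectors ℕ.+ 1))
  3<order = ℕₚ.+-mono-≤ (ℕₚ.≤-trans 3≤columns (ℕₚ.m≤m+n columns _))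
    (ℕₚ.≤-trans (ℕₚ.m≤n+m 1 (3 ℕ.* sectors)) (ℕₚ.m≤n+m _ k))

  spin-5 : ∀ r → fold r spin 5 ≡ r
  spin-5 = from-yes (Finₚ.all? λ r → fold r spin 5 Fin.≟ r)

  spin-minimal : ∀ r j → 0 ℕ.< j → j ℕ.< 5 → fold r spin j ≢ r
  spin-minimal r 1 _ _ = from-yes (Finₚ.all? λ r → ¬? (fold r spin 1 Fin.≟ r)) r
  spin-minimal r 2 _ _ = from-yes (Finₚ.all? λ r → ¬? (fold r spin 2 Fin.≟ r)) r
  spin-minimal r 3 _ _ = from-yes (Finₚ.all? λ r → ¬? (fold r spin 3 Fin.≟ r)) r
  spin-minimal r 4 _ _ = from-yes (Finₚ.all? λ r → ¬? (fold r spin 4 Fin.≟ r)) r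
  spin-minimal r (suc (suc (suc (suc (suc _))))) _ (s≤s (s≤s (s≤s (s≤s (s≤s ())))))

  -- `F` is injective and carries `spin` to `φ`, so the orbit length five carries over.
  pentagon : (F : Fin 5 → D) → (∀ r → φ (F r) ≡ F (spin r)) → Injective _≡_ _≡_ F → ∀ r → OrbitLength φ (F r) 5
  pentagon F eq F-injective r = s≤s z≤n , trans (fold-F 5) (cong F (spin-5 r))
      , λ j 0<j j<5 eq → spin-minimal r j 0<j j<5 (F-injective (trans (sym (fold-F j)) eq))
    where
    fold-F : ∀ j → fold (F r) φ j ≡ F (fold r spin j)
    fold-F zero    = refl
    fold-F (suc j) = trans (cong φ (fold-F j)) (eq _)

  pentagonal : ∀ d → faceIndex (face (O (c4 s₀))) ≢ faceIndex (face d) → OrbitLength φ d 5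
  pentagonal (O i)   other = contradiction refl other
  pentagonal (P i r) _     = pentagon (P i) (λ _ → refl) (λ { refl → refl }) r
  pentagonal (Q i r) _     = pentagon (Q i) (λ _ → refl) (λ { refl → refl }) r
  pentagonal (X s r) _     = pentagon (X s) (λ _ → refl) (λ { refl → refl }) r

  module LeftCycle = Left.Transitive left-transitive

  O-injective : ∀ {i j} → O i ≡ O j → i ≡ j
  O-injective refl = refl

  outer-length : OrbitLength φ (O (c4 s₀)) columns
  outer-length = ℕₚ.≤-trans (s≤s z≤n) 3≤columns
    , trans (fold-O _ columns) (cong O (LeftCycle.full-period _))
    , λ j 0<j j<n eq → LeftCycle.period-minimal 0<j j<n (O-injective (trans (sym (fold-O _ j)) eq))

  outer-cycle : Injective _≡_ _≡_ (λ (i : Fin columns) → tail (fold (O (c4 s₀)) φ (toℕ i)))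
  outer-cycle {i} {j} eq = LeftCycle.iterates-injective (c4 s₀) $
    -- The tail of `O i` is `a (right i)`, so a `left` has to be applied to get back to the iterate.
    trans (sym (left-right _)) $
    trans (cong left (a-injective (trans (sym (cong tail (fold-O _ (toℕ i))))
                                  (trans eq (cong tail (fold-O _ (toℕ j))))))) $
    left-right _

  pentagulation : ∃ λ (P : Pentagulation columns) → 3 -Connected Pentagulation.graph P
    × Pentagulation.pentagons P ≡ columns ℕ.+ (columns ℕ.+ sectors)
  pentagulation =
      realPentagulation (graph-connected 3<order robust) (O (c4 s₀)) 3≤columns outer-length outer-cycle pentagonal
    , threeConnected 3<order robust
    , refl
    where open Realise dartMap

-- The cyclic order of the sectors

module _ {m : ℕ} where

  -- Successor and predecessor modulo `suc m`; `view` singles out the last element, where the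
  -- successor wraps around.
  rotate unrotate : Fin (suc m) → Fin (suc m)
  rotate i with view i
  ... | ‵fromℕ     = zero
  ... | ‵inject₁ j = suc j

  unrotate zero    = Fin.fromℕ m
  unrotate (suc i) = Fin.inject₁ i

  rotate-unrotate : ∀ i → rotate (unrotate i) ≡ i
  rotate-unrotate zero    rewrite view-fromℕ m = refl
  rotate-unrotate (suc i) rewrite view-inject₁ i = refl

  unrotate-rotate : ∀ i → unrotate (rotate i) ≡ i
  unrotate-rotate i with view i
  ... | ‵fromℕ     = refl
  ... | ‵inject₁ j = refl

reach-unrotate-zero : ∀ {m} (i : Fin (suc m)) → Reach unrotate i zero
reach-unrotate-zero i = go (toℕ i) i refl
  where
  go : ∀ n (i : Fin (suc _)) → toℕ i ≡ n → Reach unrotate i zero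
  go n       zero    _  = 0 , refl
  go (suc n) (suc i) eq = reach-trans (1 , refl)
    (go n (Fin.inject₁ i) (trans (Finₚ.toℕ-inject₁ i) (ℕₚ.suc-injective eq)))

module _ (k l : ℕ) where
  private
    -- Sectors of the first kind are numbered first, so number zero is one of them and those of the
    -- second kind follow one another.
    open Inverse (↔-sym (Finₚ.+↔⊎ {suc k} {l}))

    next prev : Fin (suc k) ⊎ Fin l → Fin (suc k) ⊎ Fin l
    next = from ∘ rotate ∘ to
    prev = from ∘ unrotate ∘ to

    fold-prev : ∀ n s → fold s prev n ≡ from (fold (to s) unrotate n)
    fold-prev zero    s = sym (strictlyInverseʳ s)
    fold-prev (suc n) s = trans (cong prev (fold-prev n s)) (cong (from ∘ unrotate) (strictlyInverseˡ (fold (to s) unrotate n)))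

    next-prev : ∀ s → next (prev s) ≡ s
    next-prev s = trans (cong (from ∘ rotate) (strictlyInverseˡ (unrotate (to s))))
      (trans (cong from (rotate-unrotate (to s))) (strictlyInverseʳ s))

    prev-next : ∀ s → prev (next s) ≡ s
    prev-next s = trans (cong (from ∘ unrotate) (strictlyInverseˡ (rotate (to s))))
      (trans (cong from (unrotate-rotate (to s))) (strictlyInverseʳ s))

    reach-first : ∀ s → Reach prev s (κ zero)
    reach-first s = let n , eq = reach-unrotate-zero (to s) in n , trans (fold-prev n s) (cong from eq)

    module W = Wheel (suc k) l next prev next-prev prev-next zero reach-first

  wheel : ∃ λ (P : Pentagulation (5 ℕ.* suc k ℕ.+ 3 ℕ.* l)) → 3 -Connected Pentagulation.graph P
    × Pentagulation.pentagons P ≡ 2 ℕ.* (5 ℕ.* suc k ℕ.+ 3 ℕ.* l) ℕ.+ (suc k ℕ.+ l)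
  wheel = subst (λ n → ∃ λ (P : Pentagulation n) → 3 -Connected Pentagulation.graph P
      × Pentagulation.pentagons P ≡ 2 ℕ.* n ℕ.+ (suc k ℕ.+ l))
    (size (suc k) l)
    (let P , connected , eq = W.pentagulation in P , connected , trans eq (double W.columns (suc k ℕ.+ l)))
    where
    size : ∀ k l → 2 ℕ.* k ℕ.+ 3 ℕ.* (k ℕ.+ l) ≡ 5 ℕ.* k ℕ.+ 3 ℕ.* l
    size = solve-∀

    double : ∀ n m → n ℕ.+ (n ℕ.+ m) ≡ 2 ℕ.* n ℕ.+ m
    double = solve-∀

-- From integer parameters to a wheel

nonpositive-k : ∀ {n k l} → + 13 ≤ + n → + n ≡ + 5 * k + + 3 * l → l ≤ + 4 → ¬ k ≤ + 0
nonpositive-k {n} {k} {l} 13≤n n≡ l≤4 k≤0 = ℕₚ.1+n≰n (ℤₚ.drop‿+≤+ 13≤12)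
  where
  13≤12 : + 13 ≤ + 12
  13≤12 = ℤₚ.≤-trans (subst (+ 13 ≤_) n≡ 13≤n)
    (ℤₚ.+-mono-≤ (ℤₚ.*-monoˡ-≤-nonNeg (+ 5) k≤0) (ℤₚ.*-monoˡ-≤-nonNeg (+ 3) l≤4))

pos-linear : ∀ p q x y → + (p ℕ.* x ℕ.+ q ℕ.* y) ≡ + p * + x + + q * + y
pos-linear p q x y = trans (ℤₚ.pos-+ (p ℕ.* x) (q ℕ.* y)) (cong₂ _+_ (ℤₚ.pos-* p x) (ℤₚ.pos-* q y))

theorem1p3 : (n : ℕ) (k l : ℤ) → + 13 ≤ + n →
    + n ≡ + 5 * k + + 3 * l → + 0 ≤ l → l ≤ + 4 →
    ∃[ m ] (IsPg n m × + m ≤ + 2 * + n + k + l)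
theorem1p3 n -[1+ k ]  l     13≤n n≡ 0≤l l≤4 = contradiction -≤+ (nonpositive-k {k = -[1+ k ]} 13≤n n≡ l≤4)
theorem1p3 n (+ 0)     l     13≤n n≡ 0≤l l≤4 = contradiction ℤₚ.≤-refl (nonpositive-k {k = + 0} 13≤n n≡ l≤4)
theorem1p3 n (+ suc k) (+ l) 13≤n n≡ 0≤l l≤4
  -- With `k` and `l` natural the equation holds in the naturals, and `n` becomes the outer length
  -- of the wheel.
  with refl ← ℤₚ.+-injective (trans n≡ (sym (pos-linear 5 3 (suc k) l)))
  = let m , isPg , m≤ = exists-Pg (wheel k l) in m , isPg , subst (+ m ≤_) total (+≤+ m≤)
  where
  n′ = 5 ℕ.* suc k ℕ.+ 3 ℕ.* l

  total : + (2 ℕ.* n′ ℕ.+ (suc k ℕ.+ l)) ≡ + 2 * + n′ + + suc k + + l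
  total = trans (cong +_ (sym (ℕₚ.+-assoc (2 ℕ.* n′) (suc k) l)))
    (cong (λ x → x + + suc k + + l) (ℤₚ.pos-* 2 n′))
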